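{- Let $A$ be a formula. Any test $T$ of $A$ is correctly typeable by $A^\bot$, that is, $T\vdash_{\mathsf{MLL}^\maltese}A^\bot$.
   Context: **Nets.** Fix a countable set of positions. A hypergraph has a finite set $V$ of positions and a finite set $E$ of labelled links; each link has a source and a target, which are finite sequences of pairwise distinct positions, the source and the target being disjoint. The only links used are: tensor links $\langle p_1,p_2\rhd_\otimes p\rangle$ and par links $\langle p_1,p_2\rhd_\wp p\rangle$ (two inputs, one output), cut links $\langle p_1,p_2\rhd_{\mathsf{cut}}\rangle$ (two inputs, no output), and daimon links $\langle\rhd_\maltese p_1,\dots,p_n\rangle$, $n\ge 0$ (no input). ($\wp$ denotes the par connective.) The sum takes the union of positions and the disjoint union of links. A conclusion is a position that is in the source of no link. A (multiplicative) net $S$ is a finite sum of such links in which every position is in the target of exactly one link and in the source of at most one link, together with a total order on its conclusions; $S(i)$ is the $i$-th conclusion. A net is cut-free if it has no cut link. Nets are considered up to isomorphism. Initial positions are the outputs of daimon links. **Logic.** Propositional variables form a countable set with an involution $X\mapsto X^\bot$. Formulas: $A,B::=X\mid A\wp B\mid A\otimes B$, with $(A\wp B)^\bot=A^\bot\otimes B^\bot$, $(A\otimes B)^\bot=A^\bot\wp B^\bot$. Sequents are finite sequences of formulas. $\mathsf{MLL}^\maltese$ proofs are trees built with the rules: ($\maltese$) infer any $\Gamma$ with no premise; ($\wp$) from $\Gamma,A,B$ infer $\Gamma,A\wp B$; ($\otimes$) from $\Gamma,A$ and $\Delta,B$ infer $\Gamma,\Delta,A\otimes B$; (cut) from $\Gamma,A$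 and $\Delta,A^\bot$ infer $\Gamma,\Delta$; (ex) exchange of two consecutive formulas. A net $S$ represents a proof $\pi$ of $A_1,\dots,A_n$ (the $i$-th conclusion of $S$ corresponding to $A_i$), inductively: a $\maltese$-rule is represented by a single daimon link $\langle\rhd_\maltese p_1,\dots,p_n\rangle$ with conclusions ordered $p_1,\dots,p_n$; a $\wp$-rule by adding a par link with fresh output to the conclusions for $A,B$ of a net representing the premise; a $\otimes$-rule (resp. cut-rule) by the disjoint sum of nets representing the premises plus a tensor link with fresh output (resp. a cut link) on the conclusions for the two active formulas; exchange by exchanging the two conclusions in the order. $S\vdash_{\mathsf{MLL}^\maltese}\Gamma$ means that $S$ represents some $\mathsf{MLL}^\maltese$ proof of $\Gamma$. **Atomic testability.** A formula labelling of a cut-free net $S$ is a function $\tau$ from its positions to formulas such that $\tau(p)=\tau(p_1)\wp\tau(p_2)$ for each par link $\langle p_1,p_2\rhd_\wp p\rangle$ and $\tau(p)=\tau(p_1)\otimes\tau(p_2)$ for each tensor link $\langle p_1,p_2\rhd_\otimes p\rangle$ of $S$. It is atomic if every output of every daimon link is labelled by a propositional variable. A cut-free net $S$ with $n$ conclusions is atomically testable by $A_1,\dots,A_n$ if it has an atomic formula labelling $\tau$ with $\tau(S(i))=A_i$ for all $i$. **Natural partitions.** In such a net $S$ there is a binary tree of connective links above each conclusion; each initial position $p$ is determined by the index $i$ of the conclusion $S(i)$ below it and its address, the left/right word leading from $S(i)$ up to $p$. Order the $n$ initial positions lexicographically by (index, address), left before right. For a partition $P$ of the initial positions of $S$, $\mathbf{Nat}_S(P)$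 is the corresponding partition of $\{1,\dots,n\}$. $\mathsf P_\maltese(S)$ is the partition $\{\mathrm t(d)\mid d\text{ a daimon link of }S\}$, $\mathrm t(d)$ being the set of outputs of $d$. **Switchings.** For a par link $\langle p_1,p_2\rhd_\wp p\rangle$ of a net, a left (resp. right) switching step deletes this link and replaces $p_1$ (resp. $p_2$) by $p$ in the target of the link having it as an output; $p_2$ (resp. $p_1$) becomes a new (last) conclusion. A switching $\sigma S$ of $S$ is a normal form of $S$ for these steps (so it has no par link). Its initial positions are identified with those of $S$ via the replacements. For cut-free $S$, $\uparrow^i\sigma S$ is the partition of the initial positions having one class for each conclusion $q$ of $\sigma S$, namely the set of initial positions above $q$ in $\sigma S$ (those from which $q$ is reached by going repeatedly from an input to an output of a link). **Tests.** A cut-free net $T$ is a test of a formula $A$ if $T$ is atomically testable by $A^\bot$ and there exist a (cut-free) net $S$ atomically testable by $A$ and a switching $\sigma S$ of $S$ such that $\mathbf{Nat}_T(\mathsf P_\maltese(T))=\mathbf{Nat}_S(\uparrow^i\sigma S)$. -}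

module Defs where

open import Level using (0ℓ)
open import Data.Bool using (Bool; false; true; if_then_else_)
import Data.Bool as Bool
open import Data.Nat using (ℕ; suc; _≟_)
open import Data.Fin using (Fin; toℕ)
import Data.Fin as Fin
open import Data.List using (List; []; _∷_; _++_; _∷ʳ_; length; lookup; map; concatMap)
open import Data.List.Membership.Propositional using (_∈_; _∉_)
open import Data.List.Relation.Binary.Disjoint.Propositional using (Disjoint)
open import Data.List.Relation.Binary.Lex.Strict using (Lex-<)
open import Data.List.Relation.Binary.Permutation.Propositional using (_↭_)
open import Data.List.Relation.Unary.AllPairs using (AllPairs)
open import Data.List.Relation.Unary.Unique.Propositional using (Unique)
open import Data.Product using (∃; ∃-syntax; ∃!; _×_; _,_)
open import Data.Product.Relation.Binary.Lex.Strict using (×-Lex)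
open import Function using (_∘_; id; _⇔_; _↣_)
open import Relation.Binary.Construct.Closure.ReflexiveTransitive using (Star; ε; _◅_)
open import Relation.Binary.PropositionalEquality using (_≡_)
open import Relation.Nullary using (¬_; does)
open import Relation.Unary using (Pred; _≐_)

Pos : Set
Pos = ℕ

data Link : Set where
  tensor par : (p₁ p₂ p : Pos) → Link
  cut        : (p₁ p₂ : Pos) → Link
  daimon     : (ps : List Pos) → Link

source target : Link → List Pos
source (tensor p₁ p₂ p) = p₁ ∷ p₂ ∷ []
source (par p₁ p₂ p)    = p₁ ∷ p₂ ∷ []
source (cut p₁ p₂)      = p₁ ∷ p₂ ∷ []
source (daimon ps)      = []
target (tensor p₁ p₂ p) = p ∷ []
target (par p₁ p₂ p)    = p ∷ []
target (cut p₁ p₂)      = []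
target (daimon ps)      = ps

record WellFormed (l : Link) : Set where
  field
    source-distinct : Unique (source l)
    target-distinct : Unique (target l)
    disjoint        : Disjoint (source l) (target l)

-- A finite sum of links with an ordered list of positions.  The sum is a
-- disjoint union on links, so repetitions in the list count as different
-- links; a link of the sum is thus an element of Fin (length links).
record Graph : Set where
  constructor ⟨_∣_⟩
  field
    links       : List Link
    conclusions : List Pos

  positions : List Pos
  positions = concatMap (λ l → source l ++ target l) links

open Graph public

record IsNet (S : Graph) : Set where
  field
    wellFormed   : ∀ {l} → l ∈ links S → WellFormed l
    one-target   : ∀ {p} → p ∈ positions S →
                   ∃! _≡_ λ e → p ∈ target (lookup (links S) e)
    ≤one-source  : ∀ {p e e′} → p ∈ source (lookup (links S) e) →
                   p ∈ source (lookup (links S) e′) → e ≡ e′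
    conclusions-distinct : Unique (conclusions S)
    conclusions-exact    : ∀ {p} → p ∈ conclusions S ⇔
                           (p ∈ positions S × (∀ {l} → l ∈ links S → p ∉ source l))

record Net : Set where
  field
    graph : Graph
    isNet : IsNet graph

open Net public

CutFree : Graph → Set
CutFree S = ∀ {p₁ p₂} → cut p₁ p₂ ∉ links S

Initial : Graph → Pred Pos 0ℓ
Initial S p = ∃[ ps ] daimon ps ∈ links S × p ∈ ps

rename : (Pos → Pos) → Link → Link
rename f (tensor p₁ p₂ p) = tensor (f p₁) (f p₂) (f p)
rename f (par p₁ p₂ p)    = par (f p₁) (f p₂) (f p)
rename f (cut p₁ p₂)      = cut (f p₁) (f p₂)
rename f (daimon ps)      = daimon (map f ps)

record _≅_ (S S′ : Graph) : Set where
  field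
    to          : Pos → Pos
    injective   : ∀ {p q} → p ∈ positions S → q ∈ positions S → to p ≡ to q → p ≡ q
    links≅      : map (rename to) (links S) ↭ links S′
    conclusions≅ : map to (conclusions S) ≡ conclusions S′

-- Families of sets, compared as sets of sets.  Empty members are not
-- discarded: a daimon link without outputs contributes the empty class.

record Family (X : Set) : Set₁ where
  field
    Index : Set
    class : Index → Pred X 0ℓ

open Family public

_≋_ : ∀ {X} → Family X → Family X → Set
P ≋ Q = (∀ i → ∃[ j ] class P i ≐ class Q j) × (∀ j → ∃[ i ] class P i ≐ class Q j)

P✠ : Graph → Family Pos
P✠ S = record
  { Index = ∃[ ps ] daimon ps ∈ links S
  ; class = λ (ps , _) p → p ∈ ps
  }

Direction : Set
Direction = Bool

pattern left  = false
pattern right = true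

data Path (S : Graph) : List Direction → Pos → Pos → Set where
  here    : ∀ {p} → Path S [] p p
  tensorˡ : ∀ {w p₁ p₂ p q} → tensor p₁ p₂ p ∈ links S →
            Path S w p₁ q → Path S (left ∷ w) p q
  tensorʳ : ∀ {w p₁ p₂ p q} → tensor p₁ p₂ p ∈ links S →
            Path S w p₂ q → Path S (right ∷ w) p q
  parˡ    : ∀ {w p₁ p₂ p q} → par p₁ p₂ p ∈ links S →
            Path S w p₁ q → Path S (left ∷ w) p q
  parʳ    : ∀ {w p₁ p₂ p q} → par p₁ p₂ p ∈ links S →
            Path S w p₂ q → Path S (right ∷ w) p q

-- The index of a conclusion, and an address above it.
Location : Graph → Set
Location S = Fin (length (conclusions S)) × List Direction

_At_ : ∀ {S} → Pos → Location S → Set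
_At_ {S} p (i , w) = Path S w (lookup (conclusions S) i) p

_<loc_ : ∀ {S} → Location S → Location S → Set
_<loc_ = ×-Lex _≡_ Fin._<_ (Lex-< _≡_ Bool._<_)

Precedes : (S : Graph) → Pos → Pos → Set
Precedes S p q = ∃[ a ] ∃[ b ] _At_ {S} p a × _At_ {S} q b × _<loc_ {S} a b

record NaturalOrder (S : Graph) (ps : List Pos) : Set where
  field
    increasing : AllPairs (Precedes S) ps
    exact      : ∀ {p} → p ∈ ps ⇔ Initial S p

-- p is the k-th initial position, counting from 1.
Numbered : Graph → ℕ → Pos → Set
Numbered S k p =
  ∃[ ps ] NaturalOrder S ps × ∃[ j ] (k ≡ suc (toℕ j) × p ≡ lookup ps j)

Nat : Graph → Family Pos → Family ℕ
Nat S P = record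
  { Index = Index P
  ; class = λ i k → ∃[ p ] Numbered S k p × class P i p
  }

[_↦_] : Pos → Pos → Pos → Pos
[ x ↦ y ] z = if does (z ≟ x) then y else z

retarget : (Pos → Pos) → Link → Link
retarget f (tensor p₁ p₂ p) = tensor p₁ p₂ (f p)
retarget f (par p₁ p₂ p)    = par p₁ p₂ (f p)
retarget f (cut p₁ p₂)      = cut p₁ p₂
retarget f (daimon ps)      = daimon (map f ps)

data _⟶_ (S : Graph) : Graph → Set where
  leftStep  : ∀ ls {p₁ p₂ p} ms → links S ≡ ls ++ par p₁ p₂ p ∷ ms →
              S ⟶ ⟨ map (retarget [ p₁ ↦ p ]) (ls ++ ms) ∣ conclusions S ∷ʳ p₂ ⟩
  rightStep : ∀ ls {p₁ p₂ p} ms → links S ≡ ls ++ par p₁ p₂ p ∷ ms →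
              S ⟶ ⟨ map (retarget [ p₂ ↦ p ]) (ls ++ ms) ∣ conclusions S ∷ʳ p₁ ⟩

replacement : ∀ {S S′} → S ⟶ S′ → Pos → Pos
replacement (leftStep  _ {p₁} {p₂} {p} _ _) = [ p₁ ↦ p ]
replacement (rightStep _ {p₁} {p₂} {p} _ _) = [ p₂ ↦ p ]

record Switching (S : Graph) : Set where
  field
    result : Graph
    steps  : Star _⟶_ S result
    normal : ∀ {S′} → ¬ (result ⟶ S′)

open Switching public

identify : ∀ {S S′} → Star _⟶_ S S′ → Pos → Pos
identify ε        = id
identify (s ◅ ss) = identify ss ∘ replacement s

Below : Graph → Pos → Pos → Set
Below S p q = ∃[ l ] l ∈ links S × p ∈ source l × q ∈ target l

↑ⁱ : (S : Graph) → Switching S → Family Pos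
↑ⁱ S σ = record
  { Index = ∃[ q ] q ∈ conclusions (result σ)
  ; class = λ (q , _) p → Initial S p × Star (Below (result σ)) (identify (steps σ) p) q
  }

record PropVars : Set₁ where
  field
    Var        : Set
    neg        : Var → Var
    involutive : ∀ X → neg (neg X) ≡ X
    countable  : Var ↣ ℕ

module Logic (𝒱 : PropVars) where

  open PropVars 𝒱

  infixr 7 _⅋_ _⊗_

  data Formula : Set where
    var     : Var → Formula
    _⅋_ _⊗_ : Formula → Formula → Formula

  infix 8 _^⊥

  _^⊥ : Formula → Formula
  var X   ^⊥ = var (neg X)
  (A ⅋ B) ^⊥ = A ^⊥ ⊗ B ^⊥
  (A ⊗ B) ^⊥ = A ^⊥ ⅋ B ^⊥

  Sequent : Set
  Sequent = List Formula

  data Proof : Sequent → Set where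
    ✠-rule   : ∀ Γ → Proof Γ
    ⅋-rule   : ∀ Γ {A B} → Proof (Γ ++ A ∷ B ∷ []) → Proof (Γ ++ A ⅋ B ∷ [])
    ⊗-rule   : ∀ Γ Δ {A B} → Proof (Γ ++ A ∷ []) → Proof (Δ ++ B ∷ []) →
               Proof (Γ ++ Δ ++ A ⊗ B ∷ [])
    cut-rule : ∀ Γ Δ {A} → Proof (Γ ++ A ∷ []) → Proof (Δ ++ A ^⊥ ∷ []) →
               Proof (Γ ++ Δ)
    ex-rule  : ∀ Γ Δ {A B} → Proof (Γ ++ A ∷ B ∷ Δ) → Proof (Γ ++ B ∷ A ∷ Δ)

  data Represents : ∀ {Γ} → Graph → Proof Γ → Set where
    by-✠   : ∀ {Γ ps} → Unique ps → length ps ≡ length Γ →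
             Represents ⟨ daimon ps ∷ [] ∣ ps ⟩ (✠-rule Γ)
    by-⅋   : ∀ {Γ A B ls cs p₁ p₂ p} {π : Proof (Γ ++ A ∷ B ∷ [])} →
             (let S = ⟨ ls ∣ cs ++ p₁ ∷ p₂ ∷ [] ⟩) →
             Represents S π → p ∉ positions S →
             Represents ⟨ par p₁ p₂ p ∷ ls ∣ cs ++ p ∷ [] ⟩ (⅋-rule Γ π)
    by-⊗   : ∀ {Γ Δ A B ls ms cs ds p₁ p₂ p}
             {π : Proof (Γ ++ A ∷ [])} {ρ : Proof (Δ ++ B ∷ [])} →
             (let S = ⟨ ls ∣ cs ++ p₁ ∷ [] ⟩; R = ⟨ ms ∣ ds ++ p₂ ∷ [] ⟩) →
             Represents S π → Represents R ρ →
             Disjoint (positions S) (positions R) →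
             p ∉ positions S → p ∉ positions R →
             Represents ⟨ tensor p₁ p₂ p ∷ ls ++ ms ∣ cs ++ ds ++ p ∷ [] ⟩ (⊗-rule Γ Δ π ρ)
    by-cut : ∀ {Γ Δ A ls ms cs ds p₁ p₂}
             {π : Proof (Γ ++ A ∷ [])} {ρ : Proof (Δ ++ A ^⊥ ∷ [])} →
             (let S = ⟨ ls ∣ cs ++ p₁ ∷ [] ⟩; R = ⟨ ms ∣ ds ++ p₂ ∷ [] ⟩) →
             Represents S π → Represents R ρ →
             Disjoint (positions S) (positions R) →
             Represents ⟨ cut p₁ p₂ ∷ ls ++ ms ∣ cs ++ ds ⟩ (cut-rule Γ Δ π ρ)
    by-ex  : ∀ {Γ Δ A B ls cs ds p q} {π : Proof (Γ ++ A ∷ B ∷ Δ)} →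
             Represents ⟨ ls ∣ cs ++ p ∷ q ∷ ds ⟩ π → length cs ≡ length Γ →
             Represents ⟨ ls ∣ cs ++ q ∷ p ∷ ds ⟩ (ex-rule Γ Δ π)
    by-≅   : ∀ {Γ S S′} {π : Proof Γ} → Represents S π → S ≅ S′ → Represents S′ π

  infix 4 _⊢_

  _⊢_ : Net → Sequent → Set
  S ⊢ Γ = ∃ λ (π : Proof Γ) → Represents (graph S) π

  -- Labellings are total on Pos; only their values on the positions of S matter.
  record IsAtomicLabelling (S : Graph) (τ : Pos → Formula) : Set where
    field
      τ-par    : ∀ {p₁ p₂ p} → par p₁ p₂ p ∈ links S → τ p ≡ τ p₁ ⅋ τ p₂
      τ-tensor : ∀ {p₁ p₂ p} → tensor p₁ p₂ p ∈ links S → τ p ≡ τ p₁ ⊗ τ p₂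
      atomic   : ∀ {p} → Initial S p → ∃[ X ] τ p ≡ var X

  AtomicallyTestable : Graph → Sequent → Set
  AtomicallyTestable S Γ =
    ∃[ τ ] IsAtomicLabelling S τ × map τ (conclusions S) ≡ Γ

  record IsTest (T : Net) (A : Formula) : Set where
    field
      T-cutFree     : CutFree (graph T)
      T-testable    : AtomicallyTestable (graph T) (A ^⊥ ∷ [])
      S             : Net
      S-cutFree     : CutFree (graph S)
      S-testable    : AtomicallyTestable (graph S) (A ∷ [])
      σ             : Switching (graph S)
      samePartition : Nat (graph T) (P✠ (graph T)) ≋ Nat (graph S) (↑ⁱ (graph S) σ)

{-# OPTIONS --safe #-}

module Submission where

-- A cut-free net with one conclusion and an atomic labelling is the syntax tree
-- of its formula, with the leaves distributed among the daimons.  A switching of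
-- S therefore chooses a premise of each ⅋ of A, and its classes are computed by
-- recursion on A: a ⊗ merges the classes of its two roots, a ⅋ detaches one of
-- them.  In T the same partition is that of the daimons, while ⅋ and ⊗ are
-- exchanged: so the two premises of a par are above the same component, those of
-- a tensor are above two separate ones, and T is sequentialised by the same
-- recursion.  Switching steps may occur in any order; they are followed on the
-- forest of trees that they produce.

open import Defs
open import Data.Bool using (if_then_else_; f<t)
import Data.Bool as Bool
import Data.Bool.Properties as Bool
open import Data.Empty using (⊥; ⊥-elim)
open import Data.Fin using (Fin; zero; suc; toℕ)
import Data.Fin.Properties as Fin
open import Data.List using (List; []; _∷_; [_]; _++_; _∷ʳ_; map; concat; concatMap; lookup; length)
open import Data.List.Membership.Propositional using (_∈_; _∉_; find; lose)
open import Data.List.Membership.Propositional.Properties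
  using (∈-++⁺ˡ; ∈-++⁺ʳ; ∈-++⁻; ∈-map⁺; ∈-map⁻; ∈-insert; ∈-∃++; ∈-AllPairs₂; ∈-lookup;
         ∈-concat⁺′; ∈-concat⁻′; ∈-concatMap⁺; ∈-concatMap⁻)
open import Data.List.Membership.Propositional.Properties.WithK using (unique∧set⇒bag)
open import Data.List.Properties
  using (++-assoc; ++-identityʳ; map-++; map-∘; map-cong; map-cong-local; map-id; length-map;
         length-++; ∷-injective; concatMap-++; concat-++; tabulate-lookup)
open import Data.List.Relation.Binary.BagAndSetEquality using (∼bag⇒↭)
open import Data.List.Relation.Binary.Disjoint.Propositional using (Disjoint)
open import Data.List.Relation.Binary.Lex.Strict using (Lex-<; this; next)
import Data.List.Relation.Binary.Lex.Strict as Lex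
open import Data.List.Relation.Binary.Permutation.Propositional
  using (_↭_; ↭-refl; ↭-sym; ↭-trans; ↭-reflexive; ↭-prep; module PermutationReasoning)
import Data.List.Relation.Binary.Permutation.Propositional as Perm
open import Data.List.Relation.Binary.Permutation.Propositional.Properties
  using (++⁺; ++⁺ˡ; ++⁺ʳ; ++-comm; shift; drop-∷; ∈-resp-↭; map⁺; ++-commutativeMonoid)
import Data.List.Relation.Binary.Permutation.Setoid.Properties as Permutationₛ
open import Data.List.Relation.Binary.Pointwise using (Pointwise; []; _∷_)
open import Data.List.Relation.Unary.All using (All; []; _∷_)
import Data.List.Relation.Unary.All as All
import Data.List.Relation.Unary.All.Properties as All
open import Data.List.Relation.Unary.AllPairs using (AllPairs; []; _∷_)
import Data.List.Relation.Unary.AllPairs as AllPairs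
import Data.List.Relation.Unary.AllPairs.Properties as AllPairs
open import Data.List.Relation.Unary.Any using (here; there; any?; index)
import Data.List.Relation.Unary.Any as Any
open import Data.List.Relation.Unary.Any.Properties using (lookup-index)
open import Data.List.Relation.Unary.Unique.Propositional using (Unique)
import Data.List.Relation.Unary.Unique.Propositional.Properties as Unique
open import Data.Nat using (ℕ; zero; suc; _+_; _≤_; _<_; s≤s; _≟_)
open import Data.List.Membership.DecPropositional _≟_ using (_∈?_)
open import Data.Nat.ListAction using (sum)
open import Data.Nat.Properties
  using (≤-refl; ≤-reflexive; ≤-trans; <⇒≤; <-irrefl; <-≤-trans; ≤-<-trans; m≤m+n; m≤n+m;
         +-suc; +-monoʳ-≤; suc-injective)
open import Data.Product using (∃; ∃-syntax; ∃₂; _×_; _,_; proj₁; proj₂)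
open import Data.Sum using (_⊎_; inj₁; inj₂; [_,_]′)
open import Function using (_∘_; id; _⇔_; mk⇔; Equivalence)
open import Relation.Binary using (Symmetric; Asymmetric)
open import Relation.Binary.Construct.Closure.ReflexiveTransitive using (Star; ε; _◅_; _◅◅_)
open import Relation.Binary.PropositionalEquality
  using (_≡_; _≢_; refl; sym; trans; cong; cong₂; subst; subst₂; setoid; resp₂; ≢-sym;
         module ≡-Reasoning)
open import Relation.Nullary using (¬_; does; yes; no; contradiction)
open import Relation.Nullary.Decidable using (dec-true; dec-false)
open import Relation.Unary using (_≐_)

-- No correctness criterion is invoked: a switching for `A`, read on the dual tree, is itself the
-- plan of a proof of `A ^⊥`. Its main class is the daimon one starts from, and each detached class
-- is the daimon from which the separate premise of a tensor is started, so no splitting tensor has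
-- to be searched for. Two points need care. A net may a priori contain cycles; the number of
-- connectives in the label grows strictly along every link, which excludes them and places every
-- position above the conclusion. And the equality of partitions is one of sets of sets, blind to
-- repetitions and to the order of outputs, whereas a proof uses each daimon link once. Classes of a
-- switching are nonempty, so by that equality no daimon of `T` is empty; disjointness of targets
-- then makes the daimons pairwise distinct. The positions of the two nets are unrelated, so classes
-- are transported by a function sending the k-th leaf of `S` to the k-th leaf of `T`.

module Shuffle {A : Set} where
  open import Algebra.Solver.CommutativeMonoid (++-commutativeMonoid {A = A}) public
    using (solve; _⊕_; _⊜_)

open Shuffle

module _ {A : Set} where

  AllPairs-++⁻ : ∀ {R : A → A → Set} xs {ys} → AllPairs R (xs ++ ys) →
                 AllPairs R xs × AllPairs R ys × (∀ {x y} → x ∈ xs → y ∈ ys → R x y)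
  AllPairs-++⁻ []       ps       = [] , ps , λ ()
  AllPairs-++⁻ (x ∷ xs) (p ∷ ps) =
    let as , bs , cross = AllPairs-++⁻ xs ps in
    All.++⁻ˡ xs p ∷ as , bs , λ where
      (here refl) y∈ → All.lookup (All.++⁻ʳ xs p) y∈
      (there x∈)  y∈ → cross x∈ y∈

  AllPairs-↭ : ∀ {R : A → A → Set} → Symmetric R → ∀ {xs ys} → xs ↭ ys →
               AllPairs R xs → AllPairs R ys
  AllPairs-↭ {R} R-sym σ = Permutationₛ.AllPairs-resp-↭ (setoid A) R-sym (resp₂ R)
    (Perm.↭⇒↭ₛ σ)

-- Trees and their switchings

data Conn : Set where
  ⊗ᶜ ⅋ᶜ : Conn

link : Conn → Pos → Pos → Pos → Link
link ⊗ᶜ = tensor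
link ⅋ᶜ = par

data Tree : Set where
  leaf : Pos → Tree
  node : Conn → Pos → Tree → Tree → Tree

root : Tree → Pos
root (leaf p)       = p
root (node _ p _ _) = p

below pos leaves : Tree → List Pos
below (leaf _)       = []
below (node _ _ t u) = pos t ++ pos u
pos t = root t ∷ below t
leaves (leaf p)       = p ∷ []
leaves (node _ _ t u) = leaves t ++ leaves u

tlinks : Tree → List Link
tlinks (leaf _)       = []
tlinks (node c p t u) = link c (root t) (root u) p ∷ tlinks t ++ tlinks u

Forest : Set
Forest = List Tree

fpos : Forest → List Pos
fpos = concatMap pos

flinks : Forest → List Link
flinks = concatMap tlinks

leaf∈pos : ∀ t {x} → x ∈ leaves t → x ∈ pos t
leaf∈pos (leaf p)       x∈ = x∈
leaf∈pos (node c p t u) x∈ with ∈-++⁻ (leaves t) x∈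
... | inj₁ x∈t = there (∈-++⁺ˡ (leaf∈pos t x∈t))
... | inj₂ x∈u = there (∈-++⁺ʳ (pos t) (leaf∈pos u x∈u))

∈tlinks : ∀ t {l} → l ∈ tlinks t →
          ∃[ c ] ∃[ a ] ∃[ b ] ∃[ q ] l ≡ link c a b q × a ∈ pos t × b ∈ pos t × q ∈ pos t
∈tlinks (node c p t u) (here refl) =
  c , _ , _ , p , refl , there (here refl) , there (∈-++⁺ʳ (pos t) (here refl)) , here refl
∈tlinks (node c p t u) (there l∈) with ∈-++⁻ (tlinks t) l∈
... | inj₁ l∈t = let _ , _ , _ , _ , eq , a∈ , b∈ , q∈ = ∈tlinks t l∈t in
  _ , _ , _ , _ , eq , there (∈-++⁺ˡ a∈) , there (∈-++⁺ˡ b∈) , there (∈-++⁺ˡ q∈)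
... | inj₂ l∈u = let _ , _ , _ , _ , eq , a∈ , b∈ , q∈ = ∈tlinks u l∈u in
  _ , _ , _ , _ , eq , there (∈-++⁺ʳ (pos t) a∈) , there (∈-++⁺ʳ (pos t) b∈) , there (∈-++⁺ʳ (pos t) q∈)

-- m is the class of the root, os lists those of the detached conclusions.  For
-- c = ⅋ᶜ this is a switching of a tree; for c = ⊗ᶜ it is read on the dual tree.
data Switched (c : Conn) : Tree → List Pos → List (List Pos) → Set where
  leaf   : ∀ {p} → Switched c (leaf p) (p ∷ []) []
  join   : ∀ {d p t u m n os qs} → d ≢ c → Switched c t m os → Switched c u n qs →
           Switched c (node d p t u) (m ++ n) (os ++ qs)
  splitˡ : ∀ {p t u m n os qs} → Switched c t m os → Switched c u n qs →
           Switched c (node c p t u) m (n ∷ os ++ qs)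
  splitʳ : ∀ {p t u m n os qs} → Switched c t m os → Switched c u n qs →
           Switched c (node c p t u) n (m ∷ os ++ qs)

Switched-leaves : ∀ {c t m os} → Switched c t m os → m ++ concat os ↭ leaves t
Switched-leaves leaf = ↭-refl
Switched-leaves (join {t = t} {u} {m} {n} {os} {qs} _ σ τ) = begin
  (m ++ n) ++ concat (os ++ qs)         ≡⟨ cong ((m ++ n) ++_) (sym (concat-++ os qs)) ⟩
  (m ++ n) ++ concat os ++ concat qs    ↭⟨ solve 4 (λ m n o q → (m ⊕ n) ⊕ (o ⊕ q) ⊜ (m ⊕ o) ⊕ (n ⊕ q)) ↭-refl
                                             m n (concat os) (concat qs) ⟩
  (m ++ concat os) ++ (n ++ concat qs)  ↭⟨ ++⁺ (Switched-leaves σ) (Switched-leaves τ) ⟩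
  leaves t ++ leaves u                  ∎
  where open PermutationReasoning
Switched-leaves (splitˡ {t = t} {u} {m} {n} {os} {qs} σ τ) = begin
  m ++ n ++ concat (os ++ qs)           ≡⟨ cong (λ z → m ++ n ++ z) (sym (concat-++ os qs)) ⟩
  m ++ n ++ concat os ++ concat qs      ↭⟨ solve 4 (λ m n o q → m ⊕ (n ⊕ (o ⊕ q)) ⊜ (m ⊕ o) ⊕ (n ⊕ q)) ↭-refl
                                             m n (concat os) (concat qs) ⟩
  (m ++ concat os) ++ (n ++ concat qs)  ↭⟨ ++⁺ (Switched-leaves σ) (Switched-leaves τ) ⟩
  leaves t ++ leaves u                  ∎
  where open PermutationReasoning
Switched-leaves (splitʳ {t = t} {u} {m} {n} {os} {qs} σ τ) = begin
  n ++ m ++ concat (os ++ qs)           ≡⟨ cong (λ z → n ++ m ++ z) (sym (concat-++ os qs)) ⟩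
  n ++ m ++ concat os ++ concat qs      ↭⟨ solve 4 (λ m n o q → n ⊕ (m ⊕ (o ⊕ q)) ⊜ (m ⊕ o) ⊕ (n ⊕ q)) ↭-refl
                                             m n (concat os) (concat qs) ⟩
  (m ++ concat os) ++ (n ++ concat qs)  ↭⟨ ++⁺ (Switched-leaves σ) (Switched-leaves τ) ⟩
  leaves t ++ leaves u                  ∎
  where open PermutationReasoning

NonEmpty : List Pos → Set
NonEmpty xs = ∃[ x ] x ∈ xs

-- This is what excludes daimons without outputs from a test, and with them the possibility of
-- several identical links.
Switched-nonEmpty : ∀ {c t m os} → Switched c t m os → All NonEmpty (m ∷ os)
Switched-nonEmpty leaf = (_ , here refl) ∷ []
Switched-nonEmpty (join _ σ τ) with Switched-nonEmpty σ | Switched-nonEmpty τ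
... | (x , x∈) ∷ os | _ ∷ qs = (x , ∈-++⁺ˡ x∈) ∷ All.++⁺ os qs
Switched-nonEmpty (splitˡ σ τ) with Switched-nonEmpty σ | Switched-nonEmpty τ
... | m ∷ os | n ∷ qs = m ∷ n ∷ All.++⁺ os qs
Switched-nonEmpty (splitʳ σ τ) with Switched-nonEmpty σ | Switched-nonEmpty τ
... | m ∷ os | n ∷ qs = n ∷ m ∷ All.++⁺ os qs

-- The switching step on the par link l, of output p, keeps the premise r.  No
-- position is renamed here (the kept subtree is still rooted at r, not at p):
-- the renaming r ↦ p is recorded in the function g of Reads.
data Detach : Link → Pos → Pos → Tree → Tree → Tree → Set where
  keepˡ : ∀ {p t u} → Detach (par (root t) (root u) p) (root t) p (node ⅋ᶜ p t u) t u
  keepʳ : ∀ {p t u} → Detach (par (root t) (root u) p) (root u) p (node ⅋ᶜ p t u) u t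
  inˡ   : ∀ {l r p c q t t′ u v} → Detach l r p t t′ v →
          Detach l r p (node c q t u) (node c q t′ u) v
  inʳ   : ∀ {l r p c q t u u′ v} → Detach l r p u u′ v →
          Detach l r p (node c q t u) (node c q t u′) v

-- The detached tree is put next to the tree it leaves, while a switching step makes its root the
-- last conclusion; conclusions are therefore compared only up to permutation.
data Step (l : Link) (r p : Pos) (v : Tree) : Forest → Forest → Set where
  hd : ∀ {t t′ F} → Detach l r p t t′ v → Step l r p v (t ∷ F) (t′ ∷ v ∷ F)
  tl : ∀ {t F F′} → Step l r p v F F′ → Step l r p v (t ∷ F) (t ∷ F′)

Detach-pos : ∀ {l r p t t′ v} → Detach l r p t t′ v → pos t ↭ p ∷ pos t′ ++ pos v
Detach-pos keepˡ = ↭-refl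
Detach-pos (keepʳ {t = t} {u}) = ↭-prep _ (++-comm (pos t) (pos u))
Detach-pos (inˡ {p = p} {q = q} {t} {t′} {u} {v} D) = begin
  q ∷ pos t ++ pos u               ↭⟨ ↭-prep q (++⁺ʳ (pos u) (Detach-pos D)) ⟩
  q ∷ p ∷ (pos t′ ++ pos v) ++ pos u ↭⟨ solve 5 (λ q p t v u → q ⊕ (p ⊕ ((t ⊕ v) ⊕ u)) ⊜ p ⊕ ((q ⊕ (t ⊕ u)) ⊕ v))
                                          ↭-refl [ q ] [ p ] (pos t′) (pos v) (pos u) ⟩
  p ∷ (q ∷ pos t′ ++ pos u) ++ pos v ∎
  where open PermutationReasoning
Detach-pos (inʳ {p = p} {q = q} {t} {u} {u′} {v} D) = begin
  q ∷ pos t ++ pos u                 ↭⟨ ↭-prep q (++⁺ˡ (pos t) (Detach-pos D)) ⟩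
  q ∷ pos t ++ p ∷ (pos u′ ++ pos v) ↭⟨ solve 5 (λ q p t v u → q ⊕ (t ⊕ (p ⊕ (u ⊕ v))) ⊜ p ⊕ ((q ⊕ (t ⊕ u)) ⊕ v))
                                          ↭-refl [ q ] [ p ] (pos t) (pos v) (pos u′) ⟩
  p ∷ (q ∷ pos t ++ pos u′) ++ pos v ∎
  where open PermutationReasoning

Step-pos : ∀ {l r p v F F′} → Step l r p v F F′ → fpos F ↭ p ∷ fpos F′
Step-pos {p = p} {v} (hd {t} {t′} {F} D) = begin
  pos t ++ fpos F                  ↭⟨ ++⁺ʳ (fpos F) (Detach-pos D) ⟩
  p ∷ (pos t′ ++ pos v) ++ fpos F  ≡⟨ cong (p ∷_) (++-assoc (pos t′) _ _) ⟩
  p ∷ pos t′ ++ pos v ++ fpos F    ∎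
  where open PermutationReasoning
Step-pos {p = p} (tl {t} {F} {F′} D) = begin
  pos t ++ fpos F       ↭⟨ ++⁺ˡ (pos t) (Step-pos D) ⟩
  pos t ++ p ∷ fpos F′  ↭⟨ shift p (pos t) (fpos F′) ⟩
  p ∷ pos t ++ fpos F′  ∎
  where open PermutationReasoning

kept∈below : ∀ {l r p t t′ v} → Detach l r p t t′ v → r ∈ below t
kept∈below keepˡ             = here refl
kept∈below (keepʳ {t = t})   = ∈-++⁺ʳ (pos t) (here refl)
kept∈below (inˡ D)           = ∈-++⁺ˡ (there (kept∈below D))
kept∈below (inʳ {t = t} D)   = ∈-++⁺ʳ (pos t) (there (kept∈below D))

kept∈fpos : ∀ {l r p v F F′} → Step l r p v F F′ → r ∈ fpos F
kept∈fpos (hd D)         = ∈-++⁺ˡ (there (kept∈below D))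
kept∈fpos (tl {t = t} D) = ∈-++⁺ʳ (pos t) (kept∈fpos D)

Detach-exists : ∀ t {a b q} → par a b q ∈ tlinks t →
  (∃₂ λ t′ v → Detach (par a b q) a q t t′ v × root v ≡ b) ×
  (∃₂ λ t′ v → Detach (par a b q) b q t t′ v × root v ≡ a)
Detach-exists (node ⊗ᶜ p t u) (here ())
Detach-exists (node ⅋ᶜ p t u) (here refl) = (_ , _ , keepˡ , refl) , (_ , _ , keepʳ , refl)
Detach-exists (node c p t u) (there l∈) with ∈-++⁻ (tlinks t) l∈
... | inj₁ l∈t = let (_ , _ , D , e) , (_ , _ , D′ , e′) = Detach-exists t l∈t in
  (_ , _ , inˡ D , e) , (_ , _ , inˡ D′ , e′)
... | inj₂ l∈u = let (_ , _ , D , e) , (_ , _ , D′ , e′) = Detach-exists u l∈u in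
  (_ , _ , inʳ D , e) , (_ , _ , inʳ D′ , e′)

Step-exists : ∀ F {a b q} → par a b q ∈ flinks F →
  (∃₂ λ F′ v → Step (par a b q) a q v F F′ × root v ≡ b) ×
  (∃₂ λ F′ v → Step (par a b q) b q v F F′ × root v ≡ a)
Step-exists (t ∷ F) l∈ with ∈-++⁻ (tlinks t) l∈
... | inj₁ l∈t = let (_ , _ , D , e) , (_ , _ , D′ , e′) = Detach-exists t l∈t in
  (_ , _ , hd D , e) , (_ , _ , hd D′ , e′)
... | inj₂ l∈F = let (_ , _ , D , e) , (_ , _ , D′ , e′) = Step-exists F l∈F in
  (_ , _ , tl D , e) , (_ , _ , tl D′ , e′)

-- Undoes one detachment. The kept premise stands where the par stood, so `m` remains the main
-- class, and the main class `n` of the detached piece becomes one of the others.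
Switched-attach : ∀ {l r p t t′ v m os n qs} → Detach l r p t t′ v → Switched ⅋ᶜ t′ m os → Switched ⅋ᶜ v n qs →
            ∃[ os′ ] Switched ⅋ᶜ t m os′ × os′ ↭ os ++ n ∷ qs
Switched-attach {os = os} {n} {qs} keepˡ σ τ = _ , splitˡ σ τ , ↭-sym (shift n os qs)
Switched-attach {os = os} {n} {qs} keepʳ σ τ = _ , splitʳ τ σ ,
  solve 3 (λ n q o → n ⊕ (q ⊕ o) ⊜ o ⊕ (n ⊕ q)) ↭-refl [ n ] qs os
Switched-attach {n = n} {qs} (inˡ D) (join {os = os} {rs} ≢ σ σ′) τ =
  let os′ , σ″ , eq = Switched-attach D σ τ in
  _ , join ≢ σ″ σ′ , ↭-trans (++⁺ʳ rs eq)
    (solve 4 (λ o n q r → (o ⊕ (n ⊕ q)) ⊕ r ⊜ (o ⊕ r) ⊕ (n ⊕ q)) ↭-refl os [ n ] qs rs)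
Switched-attach {n = n} {qs} (inˡ D) (splitˡ {n = n′} {os = os} {rs} σ σ′) τ =
  let os′ , σ″ , eq = Switched-attach D σ τ in
  _ , splitˡ σ″ σ′ , ↭-prep n′ (↭-trans (++⁺ʳ rs eq)
    (solve 4 (λ o n q r → (o ⊕ (n ⊕ q)) ⊕ r ⊜ (o ⊕ r) ⊕ (n ⊕ q)) ↭-refl os [ n ] qs rs))
Switched-attach {n = n} {qs} (inˡ D) (splitʳ {m = m′} {os = os} {rs} σ σ′) τ =
  let os′ , σ″ , eq = Switched-attach D σ τ in
  _ , splitʳ σ″ σ′ , ↭-prep m′ (↭-trans (++⁺ʳ rs eq)
    (solve 4 (λ o n q r → (o ⊕ (n ⊕ q)) ⊕ r ⊜ (o ⊕ r) ⊕ (n ⊕ q)) ↭-refl os [ n ] qs rs))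
Switched-attach {n = n} {qs} (inʳ D) (join {os = os} {rs} ≢ σ σ′) τ =
  let os′ , σ″ , eq = Switched-attach D σ′ τ in
  _ , join ≢ σ σ″ , ↭-trans (++⁺ˡ os eq) (↭-reflexive (sym (++-assoc os rs _)))
Switched-attach {n = n} {qs} (inʳ D) (splitˡ {n = n′} {os = os} {rs} σ σ′) τ =
  let os′ , σ″ , eq = Switched-attach D σ′ τ in
  _ , splitˡ σ σ″ , ↭-prep n′ (↭-trans (++⁺ˡ os eq) (↭-reflexive (sym (++-assoc os rs _))))
Switched-attach {n = n} {qs} (inʳ D) (splitʳ {m = m′} {os = os} {rs} σ σ′) τ =
  let os′ , σ″ , eq = Switched-attach D σ′ τ in
  _ , splitʳ σ σ″ , ↭-prep m′ (↭-trans (++⁺ˡ os eq) (↭-reflexive (sym (++-assoc os rs _))))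

data SwitchedForest : Forest → List (List Pos) → Set where
  []  : SwitchedForest [] []
  _∷_ : ∀ {t m os F cs} → Switched ⅋ᶜ t m os → SwitchedForest F cs → SwitchedForest (t ∷ F) (m ∷ os ++ cs)

SwitchedForest-attach : ∀ {l r p v F F′ cs} → Step l r p v F F′ → SwitchedForest F′ cs →
                        ∃[ cs′ ] SwitchedForest F cs′ × cs′ ↭ cs
SwitchedForest-attach (hd D) (_∷_ {m = m} {os} σ (_∷_ {m = n} {qs} {cs = cs} τ ω)) =
  let os′ , σ′ , eq = Switched-attach D σ τ in
  _ , σ′ ∷ ω , ↭-prep m (↭-trans (++⁺ʳ cs eq) (↭-reflexive (++-assoc os (n ∷ qs) cs)))
SwitchedForest-attach (tl S) (_∷_ {m = m} {os} σ ω) =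
  let _ , ω′ , eq = SwitchedForest-attach S ω in _ , σ ∷ ω′ , ↭-prep m (++⁺ˡ os eq)

-- Switching sequences of a net, followed on forests

↦-same : ∀ x y → [ x ↦ y ] x ≡ y
↦-same x y = cong (if_then y else x) (dec-true (x ≟ x) refl)

↦-other : ∀ {x y z} → z ≢ x → [ x ↦ y ] z ≡ z
↦-other {x} {y} {z} z≢x = cong (if_then y else z) (dec-false (z ≟ x) z≢x)

-- Injectivity of `g` on the listed names, required of each pair of entries, so that the names are
-- distinct as well.
Apart : (Pos → Pos) → List Pos → Set
Apart g = AllPairs (λ a b → g a ≢ g b)

Apart-↭ : ∀ {g xs ys} → xs ↭ ys → Apart g xs → Apart g ys
Apart-↭ = AllPairs-↭ ≢-sym

-- The value `g p` is freed when the name `p` leaves the list, so redirecting `g r` to it creates no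
-- collision.
Apart-↦ : ∀ {g p xs} r → Apart g (p ∷ xs) → Apart ([ g r ↦ g p ] ∘ g) xs
Apart-↦ {g} {p} r (p# ∷ ap) = go p# ap
  where
  image : ∀ {a} → g a ≡ g r → [ g r ↦ g p ] (g a) ≡ g p
  image e = trans (cong [ g r ↦ g p ] e) (↦-same (g r) (g p))
  apart : ∀ {a b} → g p ≢ g a → g p ≢ g b → g a ≢ g b →
          [ g r ↦ g p ] (g a) ≢ [ g r ↦ g p ] (g b)
  apart {a} {b} p≢a p≢b a≢b e with g a ≟ g r | g b ≟ g r
  ... | yes a≡r | yes b≡r = a≢b (trans a≡r (sym b≡r))
  ... | yes a≡r | no  b≢r = p≢b (trans (sym (image a≡r)) (trans e (↦-other b≢r)))
  ... | no  a≢r | yes b≡r = p≢a (trans (sym (image b≡r)) (trans (sym e) (↦-other a≢r)))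
  ... | no  a≢r | no  b≢r = a≢b (trans (sym (↦-other a≢r)) (trans e (↦-other b≢r)))
  go : ∀ {xs} → All (λ a → g p ≢ g a) xs → Apart g xs → Apart ([ g r ↦ g p ] ∘ g) xs
  go []         []         = []
  go (p≢ ∷ ps) (a# ∷ ap) =
    All.map (λ (p≢b , a≢b) → apart p≢ p≢b a≢b) (All.zip (ps , a#)) ∷ go ps ap

module Moved (g : Pos → Pos) (r p : Pos) where

  f g′ : Pos → Pos
  f  = [ g r ↦ g p ]
  g′ = f ∘ g

  moved : Link → Link
  moved = retarget f ∘ rename g

  -- `retarget` alters only the output of a link, `rename g′` all three positions; hence the
  -- conditions on the inputs. In the link just below the deleted par, the old input is `p` and the
  -- new one is `r`, which `g′` reads as `g p`.
  link-moved : ∀ c {a a′ b b′ q} → g′ a′ ≡ g a → g′ b′ ≡ g b →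
               rename g′ (link c a′ b′ q) ≡ moved (link c a b q)
  link-moved ⊗ᶜ e e′ = cong₂ (λ x y → tensor x y _) e e′
  link-moved ⅋ᶜ e e′ = cong₂ (λ x y → par x y _) e e′

  -- The root is exempt from the hypothesis: within its tree it occurs only as an output, where both
  -- sides agree. This is needed for the kept subtree, whose root is `r` itself.
  untouched : ∀ t → (∀ {q} → q ∈ below t → g q ≢ g r) →
              map (rename g′) (tlinks t) ≡ map moved (tlinks t)
  untouched-++ : ∀ t u → (∀ {q} → q ∈ below t → g q ≢ g r) → (∀ {q} → q ∈ below u → g q ≢ g r) →
                 map (rename g′) (tlinks t ++ tlinks u) ≡ map moved (tlinks t ++ tlinks u)

  untouched (leaf q)       _ = refl
  untouched (node c q t u) h = cong₂ _∷_
    (link-moved c (↦-other (h (here refl))) (↦-other (h (∈-++⁺ʳ (pos t) (here refl)))))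
    (untouched-++ t u (λ q∈ → h (∈-++⁺ˡ (there q∈))) (λ q∈ → h (∈-++⁺ʳ (pos t) (there q∈))))

  untouched-++ t u h h′ = begin
    map (rename g′) (tlinks t ++ tlinks u)
      ≡⟨ map-++ _ (tlinks t) _ ⟩
    map (rename g′) (tlinks t) ++ map (rename g′) (tlinks u)
      ≡⟨ cong₂ _++_ (untouched t h) (untouched u h′) ⟩
    map moved (tlinks t) ++ map moved (tlinks u)
      ≡⟨ map-++ _ (tlinks t) _ ⟨
    map moved (tlinks t ++ tlinks u) ∎
    where open ≡-Reasoning

  untouched-F : ∀ F → (∀ {q} → q ∈ fpos F → g q ≢ g r) →
                map (rename g′) (flinks F) ≡ map moved (flinks F)
  untouched-F []      _ = refl
  untouched-F (t ∷ F) h = begin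
    map (rename g′) (tlinks t ++ flinks F)                    ≡⟨ map-++ _ (tlinks t) _ ⟩
    map (rename g′) (tlinks t) ++ map (rename g′) (flinks F)  ≡⟨ cong₂ _++_ (untouched t (λ q∈ → h (∈-++⁺ˡ (there q∈))))
                                                                           (untouched-F F (λ q∈ → h (∈-++⁺ʳ (pos t) q∈))) ⟩
    map moved (tlinks t) ++ map moved (flinks F)              ≡⟨ map-++ _ (tlinks t) _ ⟨
    map moved (tlinks t ++ flinks F)                          ∎
    where open ≡-Reasoning

  Detach-root : ∀ {l t t′ v} → Detach l r p t t′ v → Apart g (pos t) → g′ (root t′) ≡ g (root t)
  Detach-root keepˡ   _        = ↦-same (g r) (g p)
  Detach-root keepʳ   _        = ↦-same (g r) (g p)
  Detach-root D@(inˡ _) (q# ∷ _) = ↦-other (All.lookup q# (kept∈below D))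
  Detach-root D@(inʳ _) (q# ∷ _) = ↦-other (All.lookup q# (kept∈below D))

  detached≢kept : ∀ {l t t′ v} → Detach l r p t t′ v → Apart g (pos t) → g (root v) ≢ g r
  detached≢kept (keepˡ {t = t}) (_ ∷ ap) e =
    let _ , _ , t#u = AllPairs-++⁻ (pos t) ap in t#u (here refl) (here refl) (sym e)
  detached≢kept (keepʳ {t = t}) (_ ∷ ap) =
    let _ , _ , t#u = AllPairs-++⁻ (pos t) ap in t#u (here refl) (here refl)
  detached≢kept (inˡ {t = t} D) (_ ∷ ap) = detached≢kept D (proj₁ (AllPairs-++⁻ (pos t) ap))
  detached≢kept (inʳ {t = t} D) (_ ∷ ap) = detached≢kept D (proj₁ (proj₂ (AllPairs-++⁻ (pos t) ap)))

  Detach-links : ∀ {l t t′ v} → Detach l r p t t′ v → Apart g (pos t) →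
    ∃[ rest ] tlinks t ↭ l ∷ rest × map (rename g′) (tlinks t′ ++ tlinks v) ↭ map moved rest
  Detach-links (keepˡ {t = t} {u}) (_ ∷ ap) =
    let at , _ , t#u = AllPairs-++⁻ (pos t) ap in
    _ , ↭-refl , ↭-reflexive (untouched-++ t u
      (λ q∈ e → All.lookup (AllPairs.head at) q∈ (sym e))
      (λ q∈ e → t#u (here refl) (there q∈) (sym e)))
  Detach-links (keepʳ {t = t} {u}) (_ ∷ ap) =
    let _ , au , t#u = AllPairs-++⁻ (pos t) ap in
    _ , ↭-refl , ↭-trans (map⁺ _ (++-comm (tlinks u) (tlinks t))) (↭-reflexive (untouched-++ t u
      (λ q∈ → t#u (there q∈) (here refl))
      (λ q∈ e → All.lookup (AllPairs.head au) q∈ (sym e))))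
  Detach-links (inˡ {l} {c = c} {q} {t} {t′} {u} {v} D) (_ ∷ ap) =
    let at , _ , t#u    = AllPairs-++⁻ (pos t) ap
        rest , eq , eq′ = Detach-links D at
        r#u             = λ {x} (x∈ : x ∈ pos u) e → t#u (there (kept∈below D)) x∈ (sym e)
        k = link c (root t) (root u) q
        k′ = link c (root t′) (root u) q
    in
    k ∷ rest ++ tlinks u ,
    ↭-trans (↭-prep k (++⁺ʳ (tlinks u) eq))
      (solve 4 (λ k l s u → k ⊕ ((l ⊕ s) ⊕ u) ⊜ l ⊕ (k ⊕ (s ⊕ u))) ↭-refl [ k ] [ l ] rest (tlinks u)) ,
    (begin
      map (rename g′) ((k′ ∷ tlinks t′ ++ tlinks u) ++ tlinks v)
        ↭⟨ map⁺ _ (solve 4 (λ k t u v → (k ⊕ (t ⊕ u)) ⊕ v ⊜ k ⊕ ((t ⊕ v) ⊕ u)) ↭-refl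
             [ k′ ] (tlinks t′) (tlinks u) (tlinks v)) ⟩
      rename g′ k′ ∷ map (rename g′) ((tlinks t′ ++ tlinks v) ++ tlinks u)
        ≡⟨ cong₂ _∷_ (link-moved c (Detach-root D at) (↦-other (r#u (here refl))))
                     (map-++ _ (tlinks t′ ++ tlinks v) _) ⟩
      moved k ∷ map (rename g′) (tlinks t′ ++ tlinks v) ++ map (rename g′) (tlinks u)
        ↭⟨ ↭-prep _ (++⁺ eq′ (↭-reflexive (untouched u (λ q∈ → r#u (there q∈))))) ⟩
      moved k ∷ map moved rest ++ map moved (tlinks u)
        ≡⟨ cong (moved k ∷_) (map-++ _ rest _) ⟨
      map moved (k ∷ rest ++ tlinks u) ∎)
    where open PermutationReasoning
  Detach-links (inʳ {l} {c = c} {q} {t} {u} {u′} {v} D) (_ ∷ ap) =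
    let _ , au , t#u    = AllPairs-++⁻ (pos t) ap
        rest , eq , eq′ = Detach-links D au
        t#r             = λ {x} (x∈ : x ∈ pos t) → t#u x∈ (there (kept∈below D))
        k = link c (root t) (root u) q
        k′ = link c (root t) (root u′) q
    in
    k ∷ tlinks t ++ rest ,
    ↭-trans (↭-prep k (++⁺ˡ (tlinks t) eq))
      (solve 4 (λ k l s t → k ⊕ (t ⊕ (l ⊕ s)) ⊜ l ⊕ (k ⊕ (t ⊕ s))) ↭-refl [ k ] [ l ] rest (tlinks t)) ,
    (begin
      map (rename g′) ((k′ ∷ tlinks t ++ tlinks u′) ++ tlinks v)
        ≡⟨ cong (λ z → map (rename g′) (k′ ∷ z)) (++-assoc (tlinks t) _ _) ⟩
      rename g′ k′ ∷ map (rename g′) (tlinks t ++ tlinks u′ ++ tlinks v)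
        ≡⟨ cong₂ _∷_ (link-moved c (↦-other (t#r (here refl))) (Detach-root D au)) (map-++ _ (tlinks t) _) ⟩
      moved k ∷ map (rename g′) (tlinks t) ++ map (rename g′) (tlinks u′ ++ tlinks v)
        ↭⟨ ↭-prep _ (++⁺ (↭-reflexive (untouched t (λ q∈ → t#r (there q∈)))) eq′) ⟩
      moved k ∷ map moved (tlinks t) ++ map moved rest
        ≡⟨ cong (moved k ∷_) (map-++ _ (tlinks t) _) ⟨
      map moved (k ∷ tlinks t ++ rest) ∎)
    where open PermutationReasoning

  Step-links : ∀ {l v F F′} → Step l r p v F F′ → Apart g (fpos F) →
    ∃[ rest ] flinks F ↭ l ∷ rest × map (rename g′) (flinks F′) ↭ map moved rest
  Step-links {v = v} (hd {t} {t′} {F} D) ap =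
    let at , _ , t#F    = AllPairs-++⁻ (pos t) ap
        rest , eq , eq′ = Detach-links D at
    in
    rest ++ flinks F , ++⁺ʳ (flinks F) eq ,
    (begin
      map (rename g′) (tlinks t′ ++ tlinks v ++ flinks F)
        ≡⟨ cong (map (rename g′)) (++-assoc (tlinks t′) _ _) ⟨
      map (rename g′) ((tlinks t′ ++ tlinks v) ++ flinks F)
        ≡⟨ map-++ _ (tlinks t′ ++ tlinks v) _ ⟩
      map (rename g′) (tlinks t′ ++ tlinks v) ++ map (rename g′) (flinks F)
        ↭⟨ ++⁺ eq′ (↭-reflexive (untouched-F F (λ q∈ e → t#F (there (kept∈below D)) q∈ (sym e)))) ⟩
      map moved rest ++ map moved (flinks F)
        ≡⟨ map-++ _ rest _ ⟨
      map moved (rest ++ flinks F) ∎)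
    where open PermutationReasoning
  Step-links {l} (tl {t} {F} {F′} D) ap =
    let _ , aF , t#F    = AllPairs-++⁻ (pos t) ap
        rest , eq , eq′ = Step-links D aF
    in
    tlinks t ++ rest , ↭-trans (++⁺ˡ (tlinks t) eq) (shift l (tlinks t) rest) ,
    (begin
      map (rename g′) (tlinks t ++ flinks F′)
        ≡⟨ map-++ _ (tlinks t) _ ⟩
      map (rename g′) (tlinks t) ++ map (rename g′) (flinks F′)
        ↭⟨ ++⁺ (↭-reflexive (untouched t (λ q∈ → t#F (there q∈) (kept∈fpos D)))) eq′ ⟩
      map moved (tlinks t) ++ map moved rest
        ≡⟨ map-++ _ (tlinks t) _ ⟨
      map moved (tlinks t ++ rest) ∎)
    where open PermutationReasoning

  roots-untouched : ∀ F → (∀ {q} → q ∈ fpos F → g q ≢ g r) → map (g′ ∘ root) F ≡ map (g ∘ root) F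
  roots-untouched []      _ = refl
  roots-untouched (t ∷ F) h = cong₂ _∷_ (↦-other (h (here refl)))
    (roots-untouched F (λ q∈ → h (∈-++⁺ʳ (pos t) q∈)))

  Step-roots : ∀ {l v F F′} → Step l r p v F F′ → Apart g (fpos F) →
               map (g′ ∘ root) F′ ↭ g (root v) ∷ map (g ∘ root) F
  Step-roots {v = v} (hd {t} {t′} {F} D) ap =
    let at , _ , t#F = AllPairs-++⁻ (pos t) ap in begin
    g′ (root t′) ∷ g′ (root v) ∷ map (g′ ∘ root) F
      ≡⟨ cong₂ _∷_ (Detach-root D at) (cong₂ _∷_ (↦-other (detached≢kept D at))
           (roots-untouched F (λ q∈ e → t#F (there (kept∈below D)) q∈ (sym e)))) ⟩
    g (root t) ∷ g (root v) ∷ map (g ∘ root) F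
      ↭⟨ shift (g (root v)) [ g (root t) ] _ ⟩
    g (root v) ∷ g (root t) ∷ map (g ∘ root) F ∎
    where open PermutationReasoning
  Step-roots {v = v} (tl {t} {F} {F′} D) ap =
    let _ , aF , t#F = AllPairs-++⁻ (pos t) ap in begin
    g′ (root t) ∷ map (g′ ∘ root) F′
      ≡⟨ cong (_∷ _) (↦-other (t#F (here refl) (kept∈fpos D))) ⟩
    g (root t) ∷ map (g′ ∘ root) F′
      ↭⟨ ↭-prep _ (Step-roots D aF) ⟩
    g (root t) ∷ g (root v) ∷ map (g ∘ root) F
      ↭⟨ shift (g (root v)) [ g (root t) ] _ ⟩
    g (root v) ∷ g (root t) ∷ map (g ∘ root) F ∎
    where open PermutationReasoning

-- The trees of F keep the names of the positions of the initial net; g maps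
-- a name to the current position.
record Reads (S : Graph) (g : Pos → Pos) (F : Forest) : Set where
  field
    daimons      : List (List Pos)
    links↭       : links S ↭ map (rename g) (flinks F) ++ map daimon daimons
    conclusions↭ : conclusions S ↭ map (g ∘ root) F
    apart        : Apart g (fpos F)

Reads-step : ∀ {S g F l r p v F′} ls ms → Reads S g F → Step l r p v F F′ →
  links S ≡ ls ++ rename g l ∷ ms →
  Reads ⟨ map (retarget [ g r ↦ g p ]) (ls ++ ms) ∣ conclusions S ∷ʳ g (root v) ⟩
        ([ g r ↦ g p ] ∘ g) F′
Reads-step {S} {g} {F} {l} {r} {p} {v} {F′} ls ms R D eq =
  let rest , l∷rest , moved↭ = Step-links D apart
      rest↭ : ls ++ ms ↭ map (rename g) rest ++ map daimon daimons
      -- The par may stand anywhere in the list of links; cancelling it on both sides of the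
      -- permutation identifies what the step leaves.
      rest↭ = drop-∷ {x = rename g l} (begin
        rename g l ∷ ls ++ ms                                 ↭⟨ shift (rename g l) ls ms ⟨
        ls ++ rename g l ∷ ms                                 ≡⟨ eq ⟨
        links S                                               ↭⟨ links↭ ⟩
        map (rename g) (flinks F) ++ map daimon daimons       ↭⟨ ++⁺ʳ _ (map⁺ _ l∷rest) ⟩
        rename g l ∷ map (rename g) rest ++ map daimon daimons ∎)
  in record
  { daimons = map (map f) daimons
  ; links↭  = begin
      map (retarget f) (ls ++ ms)
        ↭⟨ map⁺ _ rest↭ ⟩
      map (retarget f) (map (rename g) rest ++ map daimon daimons)
        ≡⟨ map-++ _ (map (rename g) rest) _ ⟩
      map (retarget f) (map (rename g) rest) ++ map (retarget f) (map daimon daimons)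
        ≡⟨ cong₂ _++_ (map-∘ rest) (trans (sym (map-∘ daimons)) (map-∘ daimons)) ⟨
      map moved rest ++ map daimon (map (map f) daimons)
        ↭⟨ ++⁺ʳ _ moved↭ ⟨
      map (rename g′) (flinks F′) ++ map daimon (map (map f) daimons) ∎
  ; conclusions↭ = begin
      conclusions S ++ [ g (root v) ]  ↭⟨ ++-comm (conclusions S) _ ⟩
      g (root v) ∷ conclusions S       ↭⟨ ↭-prep _ conclusions↭ ⟩
      g (root v) ∷ map (g ∘ root) F    ↭⟨ Step-roots D apart ⟨
      map (g′ ∘ root) F′               ∎
  ; apart   = Apart-↦ r (Apart-↭ (Step-pos D) apart)
  }
  where
  open Reads R
  open Moved g r p
  open PermutationReasoning

rename-link : ∀ g c {a b q} → rename g (link c a b q) ≡ link c (g a) (g b) (g q)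
rename-link g ⊗ᶜ = refl
rename-link g ⅋ᶜ = refl

∈flinks : ∀ F {l} → l ∈ flinks F →
          ∃[ t ] t ∈ F × ∃[ c ] ∃[ a ] ∃[ b ] ∃[ q ] l ≡ link c a b q × a ∈ pos t × b ∈ pos t × q ∈ pos t
∈flinks (t ∷ F) l∈ with ∈-++⁻ (tlinks t) l∈
... | inj₁ l∈t = t , here refl , ∈tlinks t l∈t
... | inj₂ l∈F = let u , u∈ , rest = ∈flinks F l∈F in u , there u∈ , rest

reads-link : ∀ {S g F l} → Reads S g F → l ∈ links S →
  (∃[ l′ ] l′ ∈ flinks F × l ≡ rename g l′) ⊎ (∃[ ps ] l ≡ daimon ps)
reads-link {g = g} {F} R l∈ with ∈-++⁻ (map (rename g) (flinks F)) (∈-resp-↭ (Reads.links↭ R) l∈)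
... | inj₁ l∈F = inj₁ (∈-map⁻ (rename g) l∈F)
... | inj₂ l∈d = let ps , _ , eq = ∈-map⁻ daimon l∈d in inj₂ (ps , eq)

reads-par : ∀ {S g F x y z} → Reads S g F → par x y z ∈ links S →
  ∃[ a ] ∃[ b ] ∃[ q ] par a b q ∈ flinks F × x ≡ g a × y ≡ g b × z ≡ g q
reads-par {F = F} R l∈ with reads-link R l∈
... | inj₁ (l′ , l′∈ , eq) with ∈flinks F l′∈
...   | _ , _ , ⅋ᶜ , a , b , q , refl , _ with refl ← eq = a , b , q , l′∈ , refl , refl , refl
reads-par R l∈ | inj₁ (l′ , l′∈ , ()) | _ , _ , ⊗ᶜ , a , b , q , refl , _

-- Forests are followed forwards, but a switching is known only for the last, par-free one. What
-- accompanies each step is therefore a function that carries switchings of the later forest back to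
-- the earlier one.
simulate-step : ∀ {S S′ g F} (s : S ⟶ S′) → Reads S g F →
  ∃[ F′ ] Reads S′ (replacement s ∘ g) F′ ×
          (∀ {cs} → SwitchedForest F′ cs → ∃[ cs′ ] SwitchedForest F cs′ × cs′ ↭ cs)
simulate-step {F = F} (leftStep ls ms eq) R
  with reads-par R (subst (_ ∈_) (sym eq) (∈-insert ls))
... | a , b , q , l∈ , refl , refl , refl with Step-exists F l∈
...   | (F′ , v , D , refl) , _ = F′ , Reads-step ls ms R D eq , SwitchedForest-attach D
simulate-step {F = F} (rightStep ls ms eq) R
  with reads-par R (subst (_ ∈_) (sym eq) (∈-insert ls))
... | a , b , q , l∈ , refl , refl , refl with Step-exists F l∈
...   | _ , (F′ , v , D , refl) = F′ , Reads-step ls ms R D eq , SwitchedForest-attach D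

simulate : ∀ {S S′ g F} (ss : Star _⟶_ S S′) → Reads S g F →
  ∃[ F′ ] Reads S′ (identify ss ∘ g) F′ ×
          (∀ {cs} → SwitchedForest F′ cs → ∃[ cs′ ] SwitchedForest F cs′ × cs′ ↭ cs)
simulate ε        R = _ , R , λ ω → _ , ω , ↭-refl
simulate (s ◅ ss) R =
  let F₁ , R₁ , back₁ = simulate-step s R
      F₂ , R₂ , back₂ = simulate ss R₁
  in F₂ , R₂ , λ ω → let _ , ω₁ , eq₁ = back₂ ω ; _ , ω₂ , eq₂ = back₁ ω₁ in
     _ , ω₂ , ↭-trans eq₂ eq₁

normal⇒par-free : ∀ {S g F} → Reads S g F → (∀ {S′} → ¬ (S ⟶ S′)) → ∀ {a b q} → par a b q ∉ flinks F
normal⇒par-free {S} {g} {F} R nf l∈ =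
  let ls , ms , eq = ∈-∃++ (∈-resp-↭ (↭-sym (Reads.links↭ R)) (∈-++⁺ˡ (∈-map⁺ (rename g) l∈)))
  in nf (leftStep ls ms eq)

par-free-Switched : ∀ t → (∀ {a b q} → par a b q ∉ tlinks t) → Switched ⅋ᶜ t (leaves t) []
par-free-Switched (leaf p)        _ = leaf
par-free-Switched (node ⊗ᶜ p t u) h =
  join (λ ()) (par-free-Switched t (λ l∈ → h (there (∈-++⁺ˡ l∈))))
              (par-free-Switched u (λ l∈ → h (there (∈-++⁺ʳ (tlinks t) l∈))))
par-free-Switched (node ⅋ᶜ p t u) h = contradiction (here refl) h

par-free-SwitchedForest : ∀ F → (∀ {a b q} → par a b q ∉ flinks F) → SwitchedForest F (map leaves F)
par-free-SwitchedForest []      _ = []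
par-free-SwitchedForest (t ∷ F) h =
  par-free-Switched t (λ l∈ → h (∈-++⁺ˡ l∈)) ∷ par-free-SwitchedForest F (λ l∈ → h (∈-++⁺ʳ (tlinks t) l∈))

∈fpos : ∀ {F t q} → t ∈ F → q ∈ pos t → q ∈ fpos F
∈fpos {t ∷ F} (here refl) q∈ = ∈-++⁺ˡ q∈
∈fpos {t ∷ F} (there t∈)  q∈ = ∈-++⁺ʳ (pos t) (∈fpos t∈ q∈)

same-tree : ∀ {g F t u a b} → Apart g (fpos F) → t ∈ F → u ∈ F → a ∈ pos t → b ∈ pos u → g a ≡ g b → t ≡ u
same-tree ap (here refl) (here refl) a∈ b∈ e = refl
same-tree {F = t ∷ F} ap (here refl) (there u∈) a∈ b∈ e =
  contradiction e (proj₂ (proj₂ (AllPairs-++⁻ (pos t) ap)) a∈ (∈fpos u∈ b∈))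
same-tree {F = t ∷ F} ap (there t∈) (here refl) a∈ b∈ e =
  contradiction (sym e) (proj₂ (proj₂ (AllPairs-++⁻ (pos t) ap)) b∈ (∈fpos t∈ a∈))
same-tree {F = t ∷ F} ap (there t∈) (there u∈) a∈ b∈ e =
  same-tree (proj₁ (proj₂ (AllPairs-++⁻ (pos t) ap))) t∈ u∈ a∈ b∈ e

Below-link : ∀ {S} c {a b q} → link c a b q ∈ links S → Below S a q × Below S b q
Below-link ⊗ᶜ l∈ = (_ , l∈ , here refl , here refl) , (_ , l∈ , there (here refl) , here refl)
Below-link ⅋ᶜ l∈ = (_ , l∈ , here refl , here refl) , (_ , l∈ , there (here refl) , here refl)

-- Descent in a graph that is read as a forest

module Classes {S g F} (R : Reads S g F) where
  open Reads R

  climb : ∀ t → (∀ {l} → l ∈ tlinks t → rename g l ∈ links S) →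
          ∀ {x} → x ∈ leaves t → Star (Below S) (g x) (g (root t))
  climb (leaf p)       _   (here refl) = ε
  climb (node c p t u) sub x∈
    with Below-link {S} c (subst (_∈ links S) (rename-link g c) (sub (here refl))) | ∈-++⁻ (leaves t) x∈
  ... | t↓ , _ | inj₁ x∈t = climb t (λ l∈ → sub (there (∈-++⁺ˡ l∈))) x∈t ◅◅ t↓ ◅ ε
  ... | _ , u↓ | inj₂ x∈u = climb u (λ l∈ → sub (there (∈-++⁺ʳ (tlinks t) l∈))) x∈u ◅◅ u↓ ◅ ε

  ∈flinks⁺ : ∀ {t l} → t ∈ F → l ∈ tlinks t → rename g l ∈ links S
  ∈flinks⁺ t∈ l∈ = ∈-resp-↭ (↭-sym links↭) (∈-++⁺ˡ (∈-map⁺ (rename g)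
    (∈-concatMap⁺ tlinks (Any.map (λ where refl → l∈) t∈))))

  climb-forest : ∀ {t x} → t ∈ F → x ∈ leaves t → Star (Below S) (g x) (g (root t))
  climb-forest {t} t∈ = climb t (∈flinks⁺ t∈)

  -- Descent never leaves a tree: the inputs and the output of a connective link lie in one tree,
  -- and by `same-tree` the current position determines that tree.
  descend-step : ∀ {t a z} → t ∈ F → a ∈ pos t → Below S (g a) z → ∃[ b ] b ∈ pos t × z ≡ g b
  descend-step t∈ a∈ (l , l∈ , a∈l , z∈l) with reads-link R l∈
  descend-step t∈ a∈ (_ , l∈ , () , z∈l) | inj₂ (ps , refl)
  descend-step {t} {a} t∈ a∈ (_ , l∈ , a∈l , z∈l) | inj₁ (l′ , l′∈ , refl) with ∈flinks F l′∈
  ... | u , u∈ , c , b , b′ , q , refl , b∈ , b′∈ , q∈ = go c a∈l z∈l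
    where
    reached : ∀ {d} → d ∈ pos u → g a ≡ g d → ∃[ b ] b ∈ pos t × g q ≡ g b
    reached d∈ e with refl ← same-tree apart t∈ u∈ a∈ d∈ e = q , q∈ , refl
    go : ∀ c {z} → g a ∈ source (rename g (link c b b′ q)) → z ∈ target (rename g (link c b b′ q)) →
         ∃[ b ] b ∈ pos t × z ≡ g b
    go ⊗ᶜ (here e)         (here refl) = reached b∈ e
    go ⊗ᶜ (there (here e)) (here refl) = reached b′∈ e
    go ⅋ᶜ (here e)         (here refl) = reached b∈ e
    go ⅋ᶜ (there (here e)) (here refl) = reached b′∈ e

  descend : ∀ {t a y z} → t ∈ F → a ∈ pos t → y ≡ g a → Star (Below S) y z → ∃[ b ] b ∈ pos t × z ≡ g b
  descend t∈ a∈ e    ε        = _ , a∈ , e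
  descend t∈ a∈ refl (s ◅ ss) = let b , b∈ , e = descend-step t∈ a∈ s in descend t∈ b∈ e ss

  below-root : ∀ {t u x} → t ∈ F → u ∈ F → x ∈ leaves u → Star (Below S) (g x) (g (root t)) → x ∈ leaves t
  below-root {t} {u} t∈ u∈ x∈ ss with descend u∈ (leaf∈pos u x∈) refl ss
  ... | b , b∈ , e with refl ← same-tree apart t∈ u∈ (here refl) b∈ e = x∈

-- The tree of a labelled cut-free net

-- If the heads differed, each would occur in the tail of the other list and the two would precede
-- each other. This makes the natural enumeration of initial positions unique.
sorted-unique : ∀ {A : Set} {R : A → A → Set} → Asymmetric R → ∀ {xs ys} →
                AllPairs R xs → AllPairs R ys → (∀ {z} → z ∈ xs → z ∈ ys) → (∀ {z} → z ∈ ys → z ∈ xs) →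
                xs ≡ ys
sorted-unique asym []      []      _  _  = refl
sorted-unique asym []      (_ ∷ _) _  g  = contradiction (g (here refl)) λ ()
sorted-unique asym (_ ∷ _) []      f  _  = contradiction (f (here refl)) λ ()
sorted-unique {R = R} asym {x ∷ xs} {y ∷ ys} (p ∷ ps) (q ∷ qs) f g =
  cong₂ _∷_ x≡y (sorted-unique asym ps qs
    (λ z∈ → tail (f (there z∈)) λ where refl → irrefl p (subst (_∈ xs) (sym x≡y) z∈))
    (λ z∈ → tail (g (there z∈)) λ where refl → irrefl q (subst (_∈ ys) x≡y z∈)))
  where
  irrefl : ∀ {x xs} → All (R x) xs → x ∉ xs
  irrefl p x∈ = asym (All.lookup p x∈) (All.lookup p x∈)
  tail : ∀ {z w ws} → z ∈ w ∷ ws → z ≢ w → z ∈ ws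
  tail (here e)   ne = contradiction e ne
  tail (there z∈) _  = z∈
  x≡y : x ≡ y
  x≡y with f (here refl) | g (here refl)
  ... | here e   | _        = e
  ... | there _  | here e   = sym e
  ... | there x∈ | there y∈ = contradiction (All.lookup q x∈) (asym (All.lookup p y∈))

set⇒↭ : ∀ {A : Set} {xs ys : List A} → Unique xs → Unique ys →
        (∀ {z} → z ∈ xs → z ∈ ys) → (∀ {z} → z ∈ ys → z ∈ xs) → xs ↭ ys
set⇒↭ u u′ f g = ∼bag⇒↭ (unique∧set⇒bag u u′ (mk⇔ f g))

∈⇒≤sum : ∀ {A : Set} (f : A → ℕ) {x xs} → x ∈ xs → f x ≤ sum (map f xs)
∈⇒≤sum f (here refl)        = m≤m+n _ _
∈⇒≤sum f {xs = y ∷ _} (there x∈) = ≤-trans (∈⇒≤sum f x∈) (m≤n+m _ (f y))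

singleton-lookup : ∀ {A : Set} {xs : List A} {x} → xs ≡ x ∷ [] → (i j : Fin (length xs)) →
                   i ≡ j × lookup xs i ≡ x
singleton-lookup refl zero zero = refl , refl

IsLink : Link → Set
IsLink l = ∃[ c ] ∃[ a ] ∃[ b ] ∃[ q ] l ≡ link c a b q

link-injective : ∀ c {c′ a a′ b b′ q q′} → link c a b q ≡ link c′ a′ b′ q′ →
                 c ≡ c′ × a ≡ a′ × b ≡ b′ × q ≡ q′
link-injective ⊗ᶜ {⊗ᶜ} refl = refl , refl , refl , refl
link-injective ⅋ᶜ {⅋ᶜ} refl = refl , refl , refl , refl

link≢daimon : ∀ c {a b q ps} → link c a b q ≢ daimon ps
link≢daimon ⊗ᶜ ()
link≢daimon ⅋ᶜ ()

∈target-link : ∀ c {a b q} → q ∈ target (link c a b q)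
∈target-link ⊗ᶜ = here refl
∈target-link ⅋ᶜ = here refl

premises : ∀ t {c a b q} → link c a b q ∈ tlinks t → a ∈ pos t × b ∈ pos t
premises t {c} l∈ with ∈tlinks t l∈
... | _ , _ , _ , _ , eq , a∈ , b∈ , _ with refl , refl , refl , refl ← link-injective c eq = a∈ , b∈

pos-cases : ∀ t {q} → q ∈ pos t → q ∈ leaves t ⊎ ∃[ c ] ∃[ a ] ∃[ b ] link c a b q ∈ tlinks t
pos-cases (leaf p)       q∈          = inj₁ q∈
pos-cases (node c p t u) (here refl) = inj₂ (c , _ , _ , here refl)
pos-cases (node c p t u) (there q∈) with ∈-++⁻ (pos t) q∈
... | inj₁ q∈t with pos-cases t q∈t
...   | inj₁ leaf∈                 = inj₁ (∈-++⁺ˡ leaf∈)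
...   | inj₂ (_ , _ , _ , l∈)      = inj₂ (_ , _ , _ , there (∈-++⁺ˡ l∈))
pos-cases (node c p t u) (there q∈) | inj₂ q∈u with pos-cases u q∈u
...   | inj₁ leaf∈                 = inj₁ (∈-++⁺ʳ (leaves t) leaf∈)
...   | inj₂ (_ , _ , _ , l∈)      = inj₂ (_ , _ , _ , there (∈-++⁺ʳ (tlinks t) l∈))

tlinks-unique : ∀ t → Unique (pos t) → Unique (tlinks t)
tlinks-unique (leaf p)       _         = []
tlinks-unique (node c p t u) (p# ∷ un) =
  let ut , uu , t#u = AllPairs-++⁻ (pos t) un in
  All.tabulate (λ l∈ eq → [ fresh t (λ q∈ → ∈-++⁺ˡ q∈) eq , fresh u (∈-++⁺ʳ (pos t)) eq ]′ (∈-++⁻ (tlinks t) l∈))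
  ∷ Unique.++⁺ (tlinks-unique t ut) (tlinks-unique u uu) λ (l∈t , l∈u) →
      let c , _ , _ , _ , eq , _ , _ , q∈t = ∈tlinks t l∈t
          _ , _ , _ , _ , eq′ , _ , _ , q∈u = ∈tlinks u l∈u
          _ , _ , _ , q≡q′ = link-injective c (trans (sym eq) eq′)
      in t#u q∈t q∈u q≡q′
  where
  fresh : ∀ v → (∀ {q} → q ∈ pos v → q ∈ pos t ++ pos u) → ∀ {l} → link c (root t) (root u) p ≡ l → l ∈ tlinks v → ⊥
  fresh v sub eq l∈ =
    let _ , _ , _ , _ , eq′ , _ , _ , q∈ = ∈tlinks v l∈
        _ , _ , _ , p≡q = link-injective c (trans eq eq′)
    in All.lookup p# (sub q∈) p≡q

leaves-unique : ∀ t → Unique (pos t) → Unique (leaves t)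
leaves-unique (leaf p)       un       = un
leaves-unique (node c p t u) (_ ∷ un) =
  let ut , uu , t#u = AllPairs-++⁻ (pos t) un in
  Unique.++⁺ (leaves-unique t ut) (leaves-unique u uu)
    λ (x∈t , x∈u) → t#u (leaf∈pos t x∈t) (leaf∈pos u x∈u) refl

module Shapes (𝒱 : PropVars) where
  open Logic 𝒱

  data Shape : Tree → Formula → Set where
    leaf  : ∀ {p X} → Shape (leaf p) (var X)
    node⊗ : ∀ {p t u A B} → Shape t A → Shape u B → Shape (node ⊗ᶜ p t u) (A ⊗ B)
    node⅋ : ∀ {p t u A B} → Shape t A → Shape u B → Shape (node ⅋ᶜ p t u) (A ⅋ B)

  ⅋-injective : ∀ {A B C D} → A ⅋ B ≡ C ⅋ D → A ≡ C × B ≡ D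
  ⅋-injective refl = refl , refl

  ⊗-injective : ∀ {A B C D} → A ⊗ B ≡ C ⊗ D → A ≡ C × B ≡ D
  ⊗-injective refl = refl , refl

  op : Conn → Formula → Formula → Formula
  op ⊗ᶜ = _⊗_
  op ⅋ᶜ = _⅋_

  size : Formula → ℕ
  size (var X) = 0
  size (A ⅋ B) = suc (size A + size B)
  size (A ⊗ B) = suc (size A + size B)

  size-op : ∀ c {A B} → size A < size (op c A B) × size B < size (op c A B)
  size-op ⊗ᶜ {A} {B} = s≤s (m≤m+n _ _) , s≤s (m≤n+m _ (size A))
  size-op ⅋ᶜ {A} {B} = s≤s (m≤m+n _ _) , s≤s (m≤n+m _ (size A))

module LabelledNet (𝒱 : PropVars) (N : Net) (cutFree : CutFree (graph N))
  (τ : Pos → Logic.Formula 𝒱) (labelling : Logic.IsAtomicLabelling 𝒱 (graph N) τ)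
  (c₀ : Pos) (conclusions≡ : conclusions (graph N) ≡ c₀ ∷ []) where

  open Logic 𝒱
  open Shapes 𝒱
  open IsAtomicLabelling labelling
  open IsNet (isNet N)

  G : Graph
  G = graph N

  ∈positions : ∀ {l p} → l ∈ links G → p ∈ source l ++ target l → p ∈ positions G
  ∈positions l∈ p∈ = ∈-concatMap⁺ (λ l → source l ++ target l) (lose l∈ p∈)

  target-unique : ∀ {l l′ p} → l ∈ links G → l′ ∈ links G → p ∈ target l → p ∈ target l′ → l ≡ l′
  target-unique {l} {l′} l∈ l∈′ p∈ p∈′ =
    let e , _ , unique = one-target (∈positions l∈ (∈-++⁺ʳ (source l) p∈)) in
    trans (lookup-index l∈) (trans
      (cong (lookup (links G)) (trans (sym (unique (subst (λ z → _ ∈ target z) (lookup-index l∈) p∈)))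
                                      (unique (subst (λ z → _ ∈ target z) (lookup-index l∈′) p∈′))))
      (sym (lookup-index l∈′)))

  source-unique : ∀ {l l′ p} → l ∈ links G → l′ ∈ links G → p ∈ source l → p ∈ source l′ → l ≡ l′
  source-unique l∈ l∈′ p∈ p∈′ =
    trans (lookup-index l∈) (trans
      (cong (lookup (links G)) (≤one-source (subst (λ z → _ ∈ source z) (lookup-index l∈) p∈)
                                            (subst (λ z → _ ∈ source z) (lookup-index l∈′) p∈′)))
      (sym (lookup-index l∈′)))

  -- Being stated for pairs of occurrences, this also separates two occurrences of one link, which
  -- the equality given by `target-unique` cannot do. Repeated links without target remain possible.
  targets-disjoint : AllPairs (λ l l′ → Disjoint (target l) (target l′)) (links G)
  targets-disjoint = subst (AllPairs _) (tabulate-lookup (links G))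
    (AllPairs.tabulate⁺ λ {i} {j} i≢j (p∈ , p∈′) →
      let e , _ , unique = one-target (∈positions (∈-lookup {xs = links G} i) (∈-++⁺ʳ (source (lookup (links G) i)) p∈))
      in i≢j (trans (sym (unique p∈)) (unique p∈′)))

  classify : ∀ {l} → l ∈ links G → IsLink l ⊎ (∃[ ps ] l ≡ daimon ps)
  classify {tensor a b q} _  = inj₁ (⊗ᶜ , a , b , q , refl)
  classify {par a b q}    _  = inj₁ (⅋ᶜ , a , b , q , refl)
  classify {cut a b}      l∈ = contradiction l∈ cutFree
  classify {daimon ps}    _  = inj₂ (ps , refl)

  origin : ∀ {p} → p ∈ positions G → Initial G p ⊎ ∃[ c ] ∃[ a ] ∃[ b ] link c a b p ∈ links G
  origin p∈ with one-target p∈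
  ... | e , p∈t , _ with lookup (links G) e | ∈-lookup {xs = links G} e | p∈t
  ...   | tensor a b q | l∈ | here refl = inj₂ (⊗ᶜ , a , b , l∈)
  ...   | par a b q    | l∈ | here refl = inj₂ (⅋ᶜ , a , b , l∈)
  ...   | daimon ps    | l∈ | p∈ps      = inj₁ (ps , l∈ , p∈ps)

  τ-link : ∀ c {a b q} → link c a b q ∈ links G → τ q ≡ op c (τ a) (τ b)
  τ-link ⊗ᶜ = τ-tensor
  τ-link ⅋ᶜ = τ-par

  -- The size of the label serves as a rank: it excludes cycles, which the definition of a net does
  -- not.
  Below-grows : ∀ {a q} → Below G a q → size (τ a) < size (τ q)
  Below-grows (tensor _ _ _ , l∈ , here refl , here refl) rewrite τ-tensor l∈ = proj₁ (size-op ⊗ᶜ)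
  Below-grows (tensor x _ _ , l∈ , there (here refl) , here refl) rewrite τ-tensor l∈ = proj₂ (size-op ⊗ᶜ {A = τ x})
  Below-grows (par _ _ _ , l∈ , here refl , here refl) rewrite τ-par l∈ = proj₁ (size-op ⅋ᶜ)
  Below-grows (par x _ _ , l∈ , there (here refl) , here refl) rewrite τ-par l∈ = proj₂ (size-op ⅋ᶜ {A = τ x})

  Below*-grows : ∀ {a q} → Star (Below G) a q → size (τ a) ≤ size (τ q)
  Below*-grows ε        = ≤-refl
  Below*-grows (s ◅ ss) = ≤-trans (<⇒≤ (Below-grows s)) (Below*-grows ss)

  Below-functional : ∀ {a x y} → Below G a x → Below G a y → x ≡ y
  Below-functional (l , l∈ , a∈ , x∈) (l′ , l∈′ , a∈′ , y∈)
    with refl ← source-unique l∈ l∈′ a∈ a∈′ = same l a∈ x∈ y∈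
    where
    same : ∀ l {a x y} → a ∈ source l → x ∈ target l → y ∈ target l → x ≡ y
    same (tensor _ _ _) _ (here refl) (here refl) = refl
    same (par _ _ _)    _ (here refl) (here refl) = refl

  comparable : ∀ {q a b} → Star (Below G) q a → Star (Below G) q b →
               Star (Below G) a b ⊎ Star (Below G) b a
  comparable ε        ss′        = inj₁ ss′
  comparable (s ◅ ss) ε          = inj₂ (s ◅ ss)
  comparable (s ◅ ss) (s′ ◅ ss′) with refl ← Below-functional s s′ = comparable ss ss′

  premises-distinct : ∀ c {a b p} → link c a b p ∈ links G → a ≢ b
  premises-distinct ⊗ᶜ l∈ with (a≢b ∷ []) ∷ _ ← WellFormed.source-distinct (wellFormed l∈) = a≢b
  premises-distinct ⅋ᶜ l∈ with (a≢b ∷ []) ∷ _ ← WellFormed.source-distinct (wellFormed l∈) = a≢b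

  sibling-not-below : ∀ {a b p} → Below G a p → Below G b p → a ≢ b → ¬ Star (Below G) a b
  sibling-not-below a↓ b↓ a≢b ε        = a≢b refl
  sibling-not-below a↓ b↓ _   (s ◅ ss) with refl ← Below-functional s a↓ =
    <-irrefl refl (≤-<-trans (Below*-grows ss) (Below-grows b↓))

  -- Descent is deterministic, so the two descents from `q` are comparable and one premise would lie
  -- below the other; but leaving either premise leads to `p`, whose label is larger than both.
  -- Hence the subtrees above the two premises are disjoint.
  siblings : ∀ c {a b p q} → link c a b p ∈ links G → Star (Below G) q a → Star (Below G) q b → ⊥
  siblings c l∈ qa qb with Below-link {G} c l∈ | comparable qa qb
  ... | a↓ , b↓ | inj₁ ab = sibling-not-below a↓ b↓ (premises-distinct c l∈) ab
  ... | a↓ , b↓ | inj₂ ba = sibling-not-below b↓ a↓ (≢-sym (premises-distinct c l∈)) ba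

  record Sub (t : Tree) : Set where
    field
      tlinks⊆ : ∀ {l} → l ∈ tlinks t → l ∈ links G
      leaves⊆ : ∀ {x} → x ∈ leaves t → Initial G x

  open Sub

  Sub-node⁺ : ∀ {c p t u} → link c (root t) (root u) p ∈ links G → Sub t → Sub u → Sub (node c p t u)
  Sub-node⁺ {t = t} l∈ st su = record
    { tlinks⊆ = λ where
        (here refl) → l∈
        (there l∈′) → [ tlinks⊆ st , tlinks⊆ su ]′ (∈-++⁻ (tlinks t) l∈′)
    ; leaves⊆ = λ x∈ → [ leaves⊆ st , leaves⊆ su ]′ (∈-++⁻ (leaves t) x∈)
    }

  Sub-node⁻ : ∀ {c p t u} → Sub (node c p t u) → link c (root t) (root u) p ∈ links G × Sub t × Sub u
  Sub-node⁻ {t = t} s =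
    tlinks⊆ s (here refl) ,
    record { tlinks⊆ = λ l∈ → tlinks⊆ s (there (∈-++⁺ˡ l∈))
           ; leaves⊆ = λ x∈ → leaves⊆ s (∈-++⁺ˡ x∈) } ,
    record { tlinks⊆ = λ l∈ → tlinks⊆ s (there (∈-++⁺ʳ (tlinks t) l∈))
           ; leaves⊆ = λ x∈ → leaves⊆ s (∈-++⁺ʳ (leaves t) x∈) }

  premises∈ : ∀ c {a b q} → link c a b q ∈ links G → a ∈ positions G × b ∈ positions G
  premises∈ ⊗ᶜ l∈ = ∈positions l∈ (here refl) , ∈positions l∈ (there (here refl))
  premises∈ ⅋ᶜ l∈ = ∈positions l∈ (here refl) , ∈positions l∈ (there (here refl))

  -- The recursion is on the label, which gets smaller on the way up. It agrees with the links:
  -- atomicity refutes a compound label at an initial position, and a link forces the main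
  -- connective of its output.
  build : ∀ A {p} → p ∈ positions G → τ p ≡ A → ∃[ t ] root t ≡ p × Sub t × Shape t A
  build A {p} p∈ τp with origin p∈
  build (var X) {p} p∈ τp | inj₁ ini =
      leaf p , refl , record { tlinks⊆ = λ () ; leaves⊆ = λ where (here refl) → ini } , leaf
  build (A ⅋ B) p∈ τp | inj₁ ini with () ← trans (sym τp) (proj₂ (atomic ini))
  build (A ⊗ B) p∈ τp | inj₁ ini with () ← trans (sym τp) (proj₂ (atomic ini))
  build (var X) p∈ τp | inj₂ (⊗ᶜ , _ , _ , l∈) with () ← trans (sym τp) (τ-tensor l∈)
  build (var X) p∈ τp | inj₂ (⅋ᶜ , _ , _ , l∈) with () ← trans (sym τp) (τ-par l∈)
  build (A ⅋ B) p∈ τp | inj₂ (⊗ᶜ , _ , _ , l∈) with () ← trans (sym τp) (τ-tensor l∈)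
  build (A ⊗ B) p∈ τp | inj₂ (⅋ᶜ , _ , _ , l∈) with () ← trans (sym τp) (τ-par l∈)
  build (A ⅋ B) p∈ τp | inj₂ (⅋ᶜ , a , b , l∈)
    with premises∈ ⅋ᶜ l∈ | ⅋-injective (trans (sym (τ-par l∈)) τp)
  ... | a∈ , b∈ | τa , τb with build A a∈ τa | build B b∈ τb
  ...   | t , refl , st , sh | u , refl , su , sh′ = _ , refl , Sub-node⁺ l∈ st su , node⅋ sh sh′
  build (A ⊗ B) p∈ τp | inj₂ (⊗ᶜ , a , b , l∈)
    with premises∈ ⊗ᶜ l∈ | ⊗-injective (trans (sym (τ-tensor l∈)) τp)
  ... | a∈ , b∈ | τa , τb with build A a∈ τa | build B b∈ τb
  ...   | t , refl , st , sh | u , refl , su , sh′ = _ , refl , Sub-node⁺ l∈ st su , node⊗ sh sh′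

  c₀∈ : c₀ ∈ conclusions G
  c₀∈ = subst (c₀ ∈_) (sym conclusions≡) (here refl)

  abstract
    built : ∃[ t ] root t ≡ c₀ × Sub t × Shape t (τ c₀)
    built = build (τ c₀) (proj₁ (Equivalence.to conclusions-exact c₀∈)) refl

  tree : Tree
  tree = proj₁ built

  root≡ : root tree ≡ c₀
  root≡ = proj₁ (proj₂ built)

  tree-sub : Sub tree
  tree-sub = proj₁ (proj₂ (proj₂ built))

  tree-shape : Shape tree (τ c₀)
  tree-shape = proj₂ (proj₂ (proj₂ built))

  to-root : ∀ t → Sub t → ∀ {q} → q ∈ pos t → Star (Below G) q (root t)
  to-root t              s (here refl) = ε
  to-root (node c p t u) s (there q∈) with Sub-node⁻ s
  ... | l∈ , st , su with Below-link {G} c l∈ | ∈-++⁻ (pos t) q∈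
  ...   | t↓ , _ | inj₁ q∈t = to-root t st q∈t ◅◅ t↓ ◅ ε
  ...   | _ , u↓ | inj₂ q∈u = to-root u su q∈u ◅◅ u↓ ◅ ε

  pos-unique : ∀ t → Sub t → Unique (pos t)
  pos-unique (leaf p)       s = [] ∷ []
  pos-unique (node c p t u) s with Sub-node⁻ s
  ... | l∈ , st , su with Below-link {G} c l∈
  ...   | t↓ , u↓ =
    All.tabulate (λ q∈ → λ where
      refl → [ (λ q∈t → smaller (to-root t st q∈t) t↓)
             , (λ q∈u → smaller (to-root u su q∈u) u↓) ]′ (∈-++⁻ (pos t) q∈))
    ∷ Unique.++⁺ (pos-unique t st) (pos-unique u su)
        λ (q∈t , q∈u) → siblings c l∈ (to-root t st q∈t) (to-root u su q∈u)
    where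
    smaller : ∀ {q r} → Star (Below G) q r → Below G r q → ⊥
    smaller ss s = <-irrefl refl (≤-<-trans (Below*-grows ss) (Below-grows s))

  tree-unique : Unique (pos tree)
  tree-unique = pos-unique tree tree-sub

  link∈tree : ∀ {c a b q} → q ∈ pos tree → link c a b q ∈ links G → link c a b q ∈ tlinks tree
  link∈tree {c} q∈ l∈ with pos-cases tree q∈
  ... | inj₁ leaf∈ = let _ , d∈ , q∈ps = leaves⊆ tree-sub leaf∈ in
    contradiction (target-unique l∈ d∈ (∈target-link c) q∈ps) (link≢daimon c)
  ... | inj₂ (c′ , _ , _ , l∈′) =
    subst (_∈ tlinks tree) (target-unique (tlinks⊆ tree-sub l∈′) l∈ (∈target-link c′) (∈target-link c)) l∈′

  abstract
    -- Since labels grow, descent from `p` ends, and it can end only in a position that is no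
    -- source, which is the conclusion. Membership in the tree is then passed back up along the
    -- links of the descent.
    complete : ∀ {p} → p ∈ positions G → p ∈ pos tree
    complete = go total (m≤m+n total _)
      where
      total : ℕ
      total = sum (map (size ∘ τ) (positions G))
      -- `total` bounds the size of every label, so `n` bounds the growth still possible. Each
      -- descent spends one unit; at `zero` the next label would exceed `total`.
      go : ∀ n {p} → total ≤ n + size (τ p) → p ∈ positions G → p ∈ pos tree
      go n {p} bound p∈ with any? (λ l → p ∈? source l) (links G)
      ... | no ¬source = subst (_∈ pos tree) (trans root≡ (sym p≡c₀)) (here refl)
        where
        p≡c₀ : p ≡ c₀
        p≡c₀ with subst (p ∈_) conclusions≡ (Equivalence.from conclusions-exact (p∈ , λ l∈ p∈l → ¬source (lose l∈ p∈l)))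
        ... | here e = e
      ... | yes source∃ with find source∃
      ...   | l , l∈ , p∈l with classify l∈
      ...     | inj₁ (c , a , b , q , refl) = ∈premises c p∈l (premises tree {c} (link∈tree q∈tree l∈))
        where
        q∈ : q ∈ positions G
        q∈ = ∈positions l∈ (∈-++⁺ʳ (source (link c a b q)) (∈target-link c))
        p<q : size (τ p) < size (τ q)
        p<q = Below-grows (_ , l∈ , p∈l , ∈target-link c)
        next-fuel : ∀ n → total ≤ n + size (τ p) → q ∈ pos tree
        next-fuel zero    b = ⊥-elim (<-irrefl refl (<-≤-trans p<q (≤-trans (∈⇒≤sum (size ∘ τ) q∈) b)))
        next-fuel (suc n) b = go n (≤-trans b (≤-trans (≤-reflexive (sym (+-suc n _))) (+-monoʳ-≤ n p<q))) q∈
        q∈tree : q ∈ pos tree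
        q∈tree = next-fuel n bound
        ∈premises : ∀ c {a b q} → p ∈ source (link c a b q) → a ∈ pos tree × b ∈ pos tree → p ∈ pos tree
        ∈premises ⊗ᶜ (here refl)         (a∈ , _) = a∈
        ∈premises ⊗ᶜ (there (here refl)) (_ , b∈) = b∈
        ∈premises ⅋ᶜ (here refl)         (a∈ , _) = a∈
        ∈premises ⅋ᶜ (there (here refl)) (_ , b∈) = b∈
      go n bound p∈ | yes source∃ | l , l∈ , () | inj₂ (ps , refl)

  initial∈leaves : ∀ {x} → Initial G x → x ∈ leaves tree
  initial∈leaves {x} (ps , d∈ , x∈) with pos-cases tree (complete (∈positions d∈ x∈))
  ... | inj₁ leaf∈ = leaf∈
  ... | inj₂ (c , _ , _ , l∈) =
    contradiction (target-unique (tlinks⊆ tree-sub l∈) d∈ (∈target-link c) x∈) (link≢daimon c)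

  split : ∀ ls → (∀ {l} → l ∈ ls → l ∈ links G) →
          ∃₂ λ ks ds → ls ↭ ks ++ map daimon ds × All IsLink ks
  split []       _   = [] , [] , ↭-refl , []
  split (l ∷ ls) sub with split ls (λ l∈ → sub (there l∈)) | classify (sub (here refl))
  ... | ks , ds , eq , all | inj₁ isLink      = l ∷ ks , ds , ↭-prep l eq , isLink ∷ all
  ... | ks , ds , eq , all | inj₂ (ps , refl) =
    ks , ps ∷ ds , ↭-trans (↭-prep _ eq) (↭-sym (shift _ ks _)) , all

  abstract
    -- A connective link has an output, so disjoint targets leave no repetition among such links,
    -- and having the same members as `tlinks tree` suffices for a permutation. Daimons without
    -- output escape this argument; for daimons only disjointness is recorded.
    decomposition : ∃[ ds ] links G ↭ tlinks tree ++ map daimon ds × AllPairs Disjoint ds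
    decomposition =
      let ks , ds , eq , areLinks = split (links G) id
          disjoint , disjoint-ds , _ = AllPairs-++⁻ ks
            (AllPairs-↭ {R = λ l l′ → Disjoint (target l) (target l′)} (λ d (x∈ , y∈) → d (y∈ , x∈)) eq targets-disjoint)
          ks-unique = unique ks areLinks disjoint
          ks↭ : ks ↭ tlinks tree
          ks↭ = set⇒↭ ks-unique (tlinks-unique tree tree-unique)
            (λ l∈ → into (All.lookup areLinks l∈) (∈-resp-↭ (↭-sym eq) (∈-++⁺ˡ l∈)))
            (λ l∈ → let c , a , b , q , l≡ , _ = ∈tlinks tree l∈ in
                     outof ks ds eq (c , a , b , q , l≡) (tlinks⊆ tree-sub l∈))
      in ds , ↭-trans eq (++⁺ʳ (map daimon ds) ks↭) , AllPairs.map⁻ disjoint-ds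
      where
      unique : ∀ ks → All IsLink ks →
               AllPairs (λ l l′ → Disjoint (target l) (target l′)) ks → Unique ks
      unique []       []                              []       = []
      unique (k ∷ ks) ((c , a , b , q , refl) ∷ ls) (d ∷ ds) =
        All.map (λ dis → λ where refl → dis (∈target-link c , ∈target-link c)) d ∷ unique ks ls ds
      into : ∀ {l} → IsLink l → l ∈ links G → l ∈ tlinks tree
      into (c , a , b , q , refl) l∈ =
        link∈tree (complete (∈positions l∈ (∈-++⁺ʳ (source (link c a b q)) (∈target-link c)))) l∈
      outof : ∀ ks ds → links G ↭ ks ++ map daimon ds → ∀ {l} →
              IsLink l → l ∈ links G → l ∈ ks
      outof ks ds eq (c , a , b , q , refl) l∈ with ∈-++⁻ ks (∈-resp-↭ eq l∈)
      ... | inj₁ l∈ks = l∈ks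
      ... | inj₂ l∈ds = let _ , _ , eq′ = ∈-map⁻ daimon l∈ds in contradiction eq′ (link≢daimon c)

  -- Addresses and the natural order of the leaves

  Pathˡ : ∀ c {a b p w q} → link c a b p ∈ links G → Path G w a q → Path G (left ∷ w) p q
  Pathˡ ⊗ᶜ = tensorˡ
  Pathˡ ⅋ᶜ = parˡ

  Pathʳ : ∀ c {a b p w q} → link c a b p ∈ links G → Path G w b q → Path G (right ∷ w) p q
  Pathʳ ⊗ᶜ = tensorʳ
  Pathʳ ⅋ᶜ = parʳ

  Path-∷⁻ : ∀ {d w p q} → Path G (d ∷ w) p q →
            ∃[ c ] ∃[ a ] ∃[ b ] link c a b p ∈ links G × Path G w (if d then b else a) q
  Path-∷⁻ (tensorˡ l∈ π) = ⊗ᶜ , _ , _ , l∈ , π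
  Path-∷⁻ (tensorʳ l∈ π) = ⊗ᶜ , _ , _ , l∈ , π
  Path-∷⁻ (parˡ l∈ π)    = ⅋ᶜ , _ , _ , l∈ , π
  Path-∷⁻ (parʳ l∈ π)    = ⅋ᶜ , _ , _ , l∈ , π

  Path⇒Below* : ∀ {w p q} → Path G w p q → Star (Below G) q p
  Path⇒Below* here           = ε
  Path⇒Below* (tensorˡ l∈ π) = Path⇒Below* π ◅◅ proj₁ (Below-link {G} ⊗ᶜ l∈) ◅ ε
  Path⇒Below* (tensorʳ l∈ π) = Path⇒Below* π ◅◅ proj₂ (Below-link {G} ⊗ᶜ l∈) ◅ ε
  Path⇒Below* (parˡ l∈ π)    = Path⇒Below* π ◅◅ proj₁ (Below-link {G} ⅋ᶜ l∈) ◅ ε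
  Path⇒Below* (parʳ l∈ π)    = Path⇒Below* π ◅◅ proj₂ (Below-link {G} ⅋ᶜ l∈) ◅ ε

  no-loop : ∀ {d w p} → ¬ Path G (d ∷ w) p p
  no-loop {d} π with Path-∷⁻ π
  ... | c , a , b , l∈ , π′ with Below-link {G} c l∈
  no-loop {left}  π | c , a , b , l∈ , π′ | a↓ , b↓ =
    <-irrefl refl (≤-<-trans (Below*-grows (Path⇒Below* π′)) (Below-grows a↓))
  no-loop {right} π | c , a , b , l∈ , π′ | a↓ , b↓ =
    <-irrefl refl (≤-<-trans (Below*-grows (Path⇒Below* π′)) (Below-grows b↓))

  address-unique : ∀ w w′ {p q} → Path G w p q → Path G w′ p q → w ≡ w′
  address-unique []      []       _    _    = refl
  address-unique []      (_ ∷ _)  here π′   = contradiction π′ no-loop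
  address-unique (_ ∷ _) []       π    here = contradiction π no-loop
  address-unique (d ∷ w) (d′ ∷ w′) π π′ with Path-∷⁻ π | Path-∷⁻ π′
  ... | c , a , b , l∈ , ρ | c′ , a′ , b′ , l∈′ , ρ′
    with refl , refl , refl , _ ← link-injective c (target-unique l∈ l∈′ (∈target-link c) (∈target-link c′))
    = go d d′ ρ ρ′
    where
    go : ∀ d d′ {q} → Path G w (if d then b else a) q → Path G w′ (if d′ then b else a) q → d ∷ w ≡ d′ ∷ w′
    go left  left  ρ ρ′ = cong (left ∷_) (address-unique w w′ ρ ρ′)
    go right right ρ ρ′ = cong (right ∷_) (address-unique w w′ ρ ρ′)
    go left  right ρ ρ′ = ⊥-elim (siblings c l∈ (Path⇒Below* ρ) (Path⇒Below* ρ′))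
    go right left  ρ ρ′ = ⊥-elim (siblings c l∈ (Path⇒Below* ρ′) (Path⇒Below* ρ))

  -- `Precedes` without the index of the conclusion and with an arbitrary starting position, so that
  -- it can be established by recursion on subtrees.
  Before : Pos → Pos → Pos → Set
  Before r x y = ∃₂ λ w w′ → Path G w r x × Path G w′ r y × Lex-< _≡_ Bool._<_ w w′

  leaf-path : ∀ t → Sub t → ∀ {x} → x ∈ leaves t → ∃[ w ] Path G w (root t) x
  leaf-path (leaf p)       s (here refl) = [] , here
  leaf-path (node c p t u) s x∈ with Sub-node⁻ s
  ... | l∈ , st , su with ∈-++⁻ (leaves t) x∈
  ...   | inj₁ x∈t = let _ , π = leaf-path t st x∈t in _ , Pathˡ c l∈ π
  ...   | inj₂ x∈u = let _ , π = leaf-path u su x∈u in _ , Pathʳ c l∈ π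

  leaves-sorted : ∀ t → Sub t → AllPairs (Before (root t)) (leaves t)
  leaves-sorted (leaf p)       s = [] ∷ []
  leaves-sorted (node c p t u) s with Sub-node⁻ s
  ... | l∈ , st , su = AllPairs.++⁺
    (AllPairs.map (λ (_ , _ , π , π′ , w<w′) → _ , _ , Pathˡ c l∈ π , Pathˡ c l∈ π′ , next refl w<w′)
      (leaves-sorted t st))
    (AllPairs.map (λ (_ , _ , π , π′ , w<w′) → _ , _ , Pathʳ c l∈ π , Pathʳ c l∈ π′ , next refl w<w′)
      (leaves-sorted u su))
    (All.tabulate λ x∈ → All.tabulate λ y∈ →
      let _ , π = leaf-path t st x∈ ; _ , π′ = leaf-path u su y∈ in
      _ , _ , Pathˡ c l∈ π , Pathʳ c l∈ π′ , this f<t)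

  Before⇒Precedes : ∀ {x y} → Before (root tree) x y → Precedes G x y
  Before⇒Precedes (w , w′ , π , π′ , w<w′) =
    (index c₀∈ , w) , (index c₀∈ , w′) ,
    subst (λ r → Path G w r _) eq π , subst (λ r → Path G w′ r _) eq π′ , inj₂ (refl , w<w′)
    where
    eq : root tree ≡ lookup (conclusions G) (index c₀∈)
    eq = trans root≡ (lookup-index c₀∈)

  Precedes⇒Before : ∀ {x y} → Precedes G x y → Before c₀ x y
  Precedes⇒Before ((i , w) , (j , w′) , π , π′ , i<j)
    with refl , eq ← singleton-lookup conclusions≡ i j =
    w , w′ , subst (λ r → Path G w r _) eq π , subst (λ r → Path G w′ r _) eq π′ ,
    [ (λ i<i → contradiction i<i (Fin.<-irrefl refl)) , proj₂ ]′ i<j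

  Before-asym : ∀ {r} → Asymmetric (Before r)
  Before-asym (w , w′ , π , π′ , w<w′) (v′ , v , ρ′ , ρ , v′<v)
    with refl ← address-unique w v π ρ | refl ← address-unique w′ v′ π′ ρ′ =
    Lex.<-asymmetric sym (resp₂ Bool._<_) Bool.<-asym w<w′ v′<v

  Precedes-asym : Asymmetric (Precedes G)
  Precedes-asym p q = Before-asym (Precedes⇒Before p) (Precedes⇒Before q)

  naturalOrder : NaturalOrder G (leaves tree)
  naturalOrder = record
    { increasing = AllPairs.map Before⇒Precedes (leaves-sorted tree tree-sub)
    ; exact      = mk⇔ (leaves⊆ tree-sub) initial∈leaves
    }

  abstract
    -- `Numbered` admits any list in natural order, but sortedness leaves only the leaves read from
    -- left to right.
    Numbered⇔ : ∀ {k x} → Numbered G k x ⇔ (∃[ j ] k ≡ suc (toℕ j) × x ≡ lookup (leaves tree) j)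
    Numbered⇔ = mk⇔ to (λ (j , rest) → leaves tree , naturalOrder , j , rest)
      where
      to : ∀ {k x} → Numbered G k x → ∃[ j ] (k ≡ suc (toℕ j) × x ≡ lookup (leaves tree) j)
      to (ps , order , j , rest)
        with refl ← sorted-unique Precedes-asym (NaturalOrder.increasing order) (NaturalOrder.increasing naturalOrder)
               (λ z∈ → initial∈leaves (Equivalence.to (NaturalOrder.exact order) z∈))
               (λ z∈ → Equivalence.from (NaturalOrder.exact order) (leaves⊆ tree-sub z∈)) = j , rest

-- Sequentialisation

Unique-↭ : ∀ {A : Set} {xs ys : List A} → xs ↭ ys → Unique xs → Unique ys
Unique-↭ = AllPairs-↭ ≢-sym

Pointwise-++⁻ : ∀ {A : Set} {R : A → A → Set} {zs} xs {ys} → Pointwise R zs (xs ++ ys) →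
                ∃₂ λ zs₁ zs₂ → zs ≡ zs₁ ++ zs₂ × Pointwise R zs₁ xs × Pointwise R zs₂ ys
Pointwise-++⁻ []       rs       = [] , _ , refl , [] , rs
Pointwise-++⁻ (x ∷ xs) (r ∷ rs) =
  let _ , _ , eq , rs₁ , rs₂ = Pointwise-++⁻ xs rs in _ , _ , cong (_ ∷_) eq , r ∷ rs₁ , rs₂

Unique-concat⁻ : ∀ {A : Set} (xss : List (List A)) → Unique (concat xss) → All Unique xss × AllPairs Disjoint xss
Unique-concat⁻ []         _ = [] , []
Unique-concat⁻ (xs ∷ xss) u =
  let u-xs , u-xss , xs#xss = AllPairs-++⁻ xs u
      us , ds = Unique-concat⁻ xss u-xss
  in u-xs ∷ us , All.tabulate (λ ys∈ (x∈ , x∈′) → xs#xss x∈ (∈-concat⁺′ x∈′ ys∈) refl) ∷ ds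

disjoint⇒Unique : ∀ {xss} → All NonEmpty xss → AllPairs Disjoint xss → Unique xss
disjoint⇒Unique []               []       = []
disjoint⇒Unique ((x , x∈) ∷ ne) (d ∷ ds) =
  All.map (λ disj → λ where refl → disj (x∈ , x∈)) d ∷ disjoint⇒Unique ne ds

PositionsOf : List Link → List Pos
PositionsOf ls = positions ⟨ ls ∣ [] ⟩

∈positions-++⁻ : ∀ ls {ms q} → q ∈ PositionsOf (ls ++ ms) → q ∈ PositionsOf ls ⊎ q ∈ PositionsOf ms
∈positions-++⁻ ls q∈ = ∈-++⁻ (PositionsOf ls) (subst (_ ∈_) (concatMap-++ _ ls _) q∈)

∈positions⁻ : ∀ ls {q} → q ∈ PositionsOf ls → ∃[ l ] l ∈ ls × q ∈ source l ++ target l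
∈positions⁻ ls q∈ = find (∈-concatMap⁻ (λ l → source l ++ target l) {xs = ls} q∈)

∈positions-tlinks : ∀ t {q} → q ∈ PositionsOf (tlinks t) → q ∈ pos t
∈positions-tlinks t {q} q∈ with ∈positions⁻ (tlinks t) q∈
... | l , l∈ , q∈l with ∈tlinks t l∈
...   | c , a , b , p , refl , a∈ , b∈ , p∈ = ends c q∈l
  where
  ends : ∀ c → q ∈ source (link c a b p) ++ target (link c a b p) → q ∈ pos t
  ends ⊗ᶜ (here refl)                 = a∈
  ends ⊗ᶜ (there (here refl))         = b∈
  ends ⊗ᶜ (there (there (here refl))) = p∈
  ends ⅋ᶜ (here refl)                 = a∈
  ends ⅋ᶜ (there (here refl))         = b∈
  ends ⅋ᶜ (there (there (here refl))) = p∈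

rename-id : ∀ l → rename id l ≡ l
rename-id (tensor _ _ _) = refl
rename-id (par _ _ _)    = refl
rename-id (cut _ _)      = refl
rename-id (daimon ps)    = cong daimon (map-id ps)

module Sequentialisation (𝒱 : PropVars) (τ : Pos → Logic.Formula 𝒱) where
  open Logic 𝒱
  open Shapes 𝒱

  Provable : Sequent → List Link → List Pos → Set
  Provable Γ ls cs = ∃ λ (π : Proof Γ) → Represents ⟨ ls ∣ cs ⟩ π

  -- The sequent is read off the labels of the conclusions, so that only positions have to be
  -- tracked.
  Seq : List Link → List Pos → Set
  Seq ls cs = Provable (map τ cs) ls cs

  links-↭ : ∀ {Γ ls ms cs} → ls ↭ ms → Provable Γ ls cs → Provable Γ ms cs
  links-↭ {ls = ls} {cs = cs} eq (π , R) = π , by-≅ R record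
    { to           = id
    ; injective    = λ _ _ e → e
    ; links≅       = ↭-trans (↭-reflexive (trans (map-cong rename-id ls) (map-id ls))) eq
    ; conclusions≅ = map-id cs
    }

  exchange : ∀ {ls} cs {p q ds} → Seq ls (cs ++ p ∷ q ∷ ds) → Seq ls (cs ++ q ∷ p ∷ ds)
  exchange {ls} cs {p} {q} {ds} S
    with π , R ← subst (λ Γ → Provable Γ ls (cs ++ p ∷ q ∷ ds)) (map-++ τ cs (p ∷ q ∷ ds)) S =
    subst (λ Γ → Provable Γ ls (cs ++ q ∷ p ∷ ds)) (sym (map-++ τ cs (q ∷ p ∷ ds)))
      (_ , by-ex R (sym (length-map τ cs)))

  -- The prefix `bs` collects the entries that the permutation has already passed, since exchange
  -- acts at any depth of the sequent.
  permute : ∀ {ls} bs {cs ds} → cs ↭ ds → Seq ls (bs ++ cs) → Seq ls (bs ++ ds)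
  permute bs Perm.refl S = S
  permute {ls} bs (Perm.prep {cs} {ds} x σ) S =
    subst (Seq ls) (++-assoc bs [ x ] ds) (permute (bs ++ [ x ]) σ (subst (Seq ls) (sym (++-assoc bs [ x ] cs)) S))
  permute {ls} bs (Perm.swap {cs} {ds} x y σ) S =
    subst (Seq ls) (++-assoc bs (y ∷ x ∷ []) ds) (permute (bs ++ y ∷ x ∷ []) σ
      (subst (Seq ls) (sym (++-assoc bs (y ∷ x ∷ []) cs)) (exchange bs S)))
  permute bs (Perm.trans σ σ′) S = permute bs σ′ (permute bs σ S)

  daimon-rule : ∀ {ps} → Unique ps → Seq [ daimon ps ] ps
  daimon-rule {ps} u = _ , by-✠ u (sym (length-map τ ps))

  par-rule : ∀ {ls p₁ p₂ p} cs → τ p ≡ τ p₁ ⅋ τ p₂ → p ∉ PositionsOf ls →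
             Seq ls (cs ++ p₁ ∷ p₂ ∷ []) → Seq (par p₁ p₂ p ∷ ls) (cs ++ p ∷ [])
  par-rule {ls} {p₁} {p₂} {p} cs τp p∉ S
    with π , R ← subst (λ Γ → Provable Γ ls (cs ++ p₁ ∷ p₂ ∷ [])) (map-++ τ cs (p₁ ∷ p₂ ∷ [])) S =
    subst (λ Γ → Provable Γ (par p₁ p₂ p ∷ ls) (cs ++ p ∷ []))
      (sym (trans (map-++ τ cs (p ∷ [])) (cong (λ A → map τ cs ++ A ∷ []) τp)))
      (_ , by-⅋ R p∉)

  tensor-rule : ∀ {ls ms p₁ p₂ p} cs ds → τ p ≡ τ p₁ ⊗ τ p₂ →
                Disjoint (PositionsOf ls) (PositionsOf ms) → p ∉ PositionsOf ls → p ∉ PositionsOf ms →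
                Seq ls (cs ++ p₁ ∷ []) → Seq ms (ds ++ p₂ ∷ []) →
                Seq (tensor p₁ p₂ p ∷ ls ++ ms) (cs ++ ds ++ p ∷ [])
  tensor-rule {ls} {ms} {p₁} {p₂} {p} cs ds τp disjoint p∉ p∉′ S S′
    with π , R ← subst (λ Γ → Provable Γ ls (cs ++ p₁ ∷ [])) (map-++ τ cs (p₁ ∷ [])) S
       | ρ , R′ ← subst (λ Γ → Provable Γ ms (ds ++ p₂ ∷ [])) (map-++ τ ds (p₂ ∷ [])) S′ =
    subst (λ Γ → Provable Γ (tensor p₁ p₂ p ∷ ls ++ ms) (cs ++ ds ++ p ∷ []))
      (sym (trans (map-++ τ cs _) (cong (map τ cs ++_)
        (trans (map-++ τ ds (p ∷ [])) (cong (λ A → map τ ds ++ A ∷ []) τp)))))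
      (_ , by-⊗ R R′ disjoint p∉ p∉′)

  main⊆pos : ∀ {t m os q} → Switched ⊗ᶜ t m os → q ∈ m → q ∈ pos t
  main⊆pos {t} σ q∈ = leaf∈pos t (∈-resp-↭ (Switched-leaves σ) (∈-++⁺ˡ q∈))

  others⊆pos : ∀ {t m os D q} → Switched ⊗ᶜ t m os → Pointwise _↭_ D os → q ∈ PositionsOf (map daimon D) → q ∈ pos t
  others⊆pos {t} {m} {D = D} σ rs q∈ with ∈positions⁻ (map daimon D) q∈
  ... | l , l∈ , q∈l with ∈-map⁻ daimon l∈
  ...   | d , d∈ , refl = leaf∈pos t (∈-resp-↭ (Switched-leaves σ) (∈-++⁺ʳ m (go rs d∈ q∈l)))
    where
    go : ∀ {D os d} → Pointwise _↭_ D os → d ∈ D → _ ∈ d → _ ∈ concat os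
    go (r ∷ _)           (here refl) q∈ = ∈-++⁺ˡ (∈-resp-↭ r q∈)
    go (_∷_ {y = o} _ rs) (there d∈)  q∈ = ∈-++⁺ʳ o (go rs d∈ q∈)

  extended : ∀ {t m os D} ls {q} → Switched ⊗ᶜ t m os → Pointwise _↭_ D os →
             q ∈ PositionsOf (ls ++ tlinks t ++ map daimon D) → q ∈ PositionsOf ls ⊎ q ∈ pos t
  extended {t} ls σ rs q∈ with ∈positions-++⁻ ls q∈
  ... | inj₁ q∈ls = inj₁ q∈ls
  ... | inj₂ q∈′ with ∈positions-++⁻ (tlinks t) q∈′
  ...   | inj₁ q∈t = inj₂ (∈positions-tlinks t q∈t)
  ...   | inj₂ q∈D = inj₂ (others⊆pos σ rs q∈D)

  Labelled : Tree → Set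
  Labelled t = ∀ {c a b q} → link c a b q ∈ tlinks t → τ q ≡ op c (τ a) (τ b)

  -- The freshness invariant: a net under construction shares with the tree still to be added at
  -- most leaves of the main class, so the outputs of the new connectives are fresh.
  MeetsIn : List Link → Tree → List Pos → Set
  MeetsIn ls t m = ∀ {q} → q ∈ PositionsOf ls → q ∈ pos t → q ∈ m

  main-unique : ∀ {t m os} → Switched ⊗ᶜ t m os → Unique (pos t) → Unique m
  main-unique {t} {m} σ u = proj₁ (AllPairs-++⁻ m (Unique-↭ (↭-sym (Switched-leaves σ)) (leaves-unique t u)))

  ∈daimon⁻ : ∀ {d m q} → d ↭ m → q ∈ PositionsOf [ daimon d ] → q ∈ m
  ∈daimon⁻ {d} r q∈ = ∈-resp-↭ r (subst (_ ∈_) (++-identityʳ d) q∈)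

  start : ∀ {t m os d} → Switched ⊗ᶜ t m os → Unique (pos t) → d ↭ m → Seq [ daimon d ] m
  start σ u r = permute [] r (daimon-rule (Unique-↭ (↭-sym r) (main-unique σ u)))

  node-parts : ∀ {p} t u → Unique (p ∷ pos t ++ pos u) →
               Unique (pos t) × Unique (pos u) × Disjoint (pos t) (pos u) × p ∉ pos t × p ∉ pos u
  node-parts t u (p# ∷ un) =
    let ut , uu , t#u = AllPairs-++⁻ (pos t) un in
    ut , uu , (λ (x∈ , y∈) → t#u x∈ y∈ refl) ,
    (λ p∈ → All.lookup p# (∈-++⁺ˡ p∈) refl) , (λ p∈ → All.lookup p# (∈-++⁺ʳ (pos t) p∈) refl)

  Labelled-parts : ∀ {c p} t u → Labelled (node c p t u) → Labelled t × Labelled u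
  Labelled-parts t u lab =
    (λ {c} l∈ → lab {c} (there (∈-++⁺ˡ l∈))) , (λ {c} l∈ → lab {c} (there (∈-++⁺ʳ (tlinks t) l∈)))

  separate : ∀ {t m os D u n qs d E p} ls → Switched ⊗ᶜ t m os → Pointwise _↭_ D os → Switched ⊗ᶜ u n qs →
    Pointwise _↭_ E qs → d ↭ n → Disjoint (pos t) (pos u) → p ∉ pos t → p ∉ pos u →
    (∀ {q} → q ∈ PositionsOf ls → q ∉ p ∷ pos u) →
    let ls₁ = ls ++ tlinks t ++ map daimon D ; ls₂ = [ daimon d ] ++ tlinks u ++ map daimon E in
    Disjoint (PositionsOf ls₁) (PositionsOf ls₂) × p ∉ PositionsOf ls₁ × p ∉ PositionsOf ls₂
  separate {u = u} {d = d} {E = E} ls σ rs σ′ rs′ r t#u p∉t p∉u ls# =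
    (λ (q∈ , q∈′) → [ (λ q∈ls → ls# q∈ls (there (in-u q∈′)))
                    , (λ q∈t → t#u (q∈t , in-u q∈′)) ]′ (extended ls σ rs q∈)) ,
    (λ p∈ → [ (λ p∈ls → ls# p∈ls (here refl)) , p∉t ]′ (extended ls σ rs p∈)) ,
    (λ p∈ → p∉u (in-u p∈))
    where
    in-u : ∀ {q} → q ∈ PositionsOf ([ daimon d ] ++ tlinks u ++ map daimon E) → q ∈ pos u
    in-u q∈ = [ (λ q∈d → main⊆pos σ′ (∈daimon⁻ r q∈d)) , id ]′ (extended [ daimon d ] σ′ rs′ q∈)

  -- The connectives of t are added to a net that contains, among its
  -- conclusions, the leaves in the main class; the other classes are supplied
  -- by the daimons D when a tensor requires a second premise.
  sequentialise : ∀ {t m os D ls} cs → Switched ⊗ᶜ t m os → Labelled t → Unique (pos t) → Pointwise _↭_ D os →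
                  MeetsIn ls t m → Seq ls (cs ++ m) →
                  Seq (ls ++ tlinks t ++ map daimon D) (cs ++ [ root t ])
  sequentialise {ls = ls} cs leaf lab un [] meets S = subst (λ ks → Seq ks _) (sym (++-identityʳ ls)) S
  sequentialise cs (join {⊗ᶜ} d≢ σ σ′) lab un rs meets S = contradiction refl d≢
  sequentialise {ls = ls} cs (join {⅋ᶜ} {p} {t} {u} {m} {n} {os} {qs} _ σ σ′) lab un rs meets S
    with D₁ , D₂ , refl , rs₁ , rs₂ ← Pointwise-++⁻ os rs
       | ut , uu , t#u , p∉t , p∉u ← node-parts t u un
       | lab-t , lab-u ← Labelled-parts {⅋ᶜ} {p} t u lab =
    let
      ls₂ = ls ++ tlinks u ++ map daimon D₂

      meets-u : MeetsIn ls u n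
      meets-u q∈ls q∈u = [ (λ q∈m → ⊥-elim (t#u (main⊆pos σ q∈m , q∈u))) , id ]′
        (∈-++⁻ m (meets q∈ls (there (∈-++⁺ʳ (pos t) q∈u))))

      meets-t : MeetsIn ls₂ t m
      meets-t q∈ q∈t = [ (λ q∈ls → [ id , (λ q∈n → ⊥-elim (t#u (q∈t , main⊆pos σ′ q∈n))) ]′
                                     (∈-++⁻ m (meets q∈ls (there (∈-++⁺ˡ q∈t)))))
                       , (λ q∈u → ⊥-elim (t#u (q∈t , q∈u))) ]′ (extended ls σ′ rs₂ q∈)

      p∉ : p ∉ PositionsOf (ls₂ ++ tlinks t ++ map daimon D₁)
      p∉ p∈ = [ (λ p∈ls₂ → [ (λ p∈ls → [ p∉t ∘ main⊆pos σ , p∉u ∘ main⊆pos σ′ ]′ (∈-++⁻ m (meets p∈ls (here refl))))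
                           , p∉u ]′ (extended ls σ′ rs₂ p∈ls₂))
              , p∉t ]′ (extended ls₂ σ rs₁ p∈)

      k = par (root t) (root u) p

      -- A par needs both premises in one net: `u` is added while the class `m` of `t` waits in the
      -- context, then `t` is added while `root u` waits there.
      S₂ : Seq ls₂ ((cs ++ m) ++ [ root u ])
      S₂ = sequentialise (cs ++ m) σ′ lab-u uu rs₂ meets-u (subst (Seq ls) (sym (++-assoc cs m n)) S)

      S₂′ : Seq ls₂ ((cs ++ [ root u ]) ++ m)
      S₂′ = subst (Seq ls₂) (sym (++-assoc cs [ root u ] m))
        (permute cs (++-comm m [ root u ]) (subst (Seq ls₂) (++-assoc cs m [ root u ]) S₂))

      S₁ : Seq (ls₂ ++ tlinks t ++ map daimon D₁) ((cs ++ [ root u ]) ++ [ root t ])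
      S₁ = sequentialise (cs ++ [ root u ]) σ lab-t ut rs₁ meets-t S₂′
    in
    links-↭
      (↭-trans
        (solve 6 (λ k l t u d e → k ⊕ ((l ⊕ (u ⊕ e)) ⊕ (t ⊕ d)) ⊜ l ⊕ ((k ⊕ (t ⊕ u)) ⊕ (d ⊕ e))) ↭-refl
          [ k ] ls (tlinks t) (tlinks u) (map daimon D₁) (map daimon D₂))
        (↭-reflexive (cong (λ ds → ls ++ (k ∷ tlinks t ++ tlinks u) ++ ds) (sym (map-++ daimon D₁ D₂)))))
      (par-rule cs (lab {⅋ᶜ} (here refl)) p∉
        (permute cs (++-comm [ root u ] [ root t ]) (subst (Seq _) (++-assoc cs [ root u ] [ root t ]) S₁)))
  sequentialise {ls = ls} cs (splitˡ {p} {t} {u} {m} {n} {os} {qs} σ σ′) lab un (_∷_ {x = d} r rs) meets S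
    with D₁ , D₂ , refl , rs₁ , rs₂ ← Pointwise-++⁻ os rs
       | ut , uu , t#u , p∉t , p∉u ← node-parts t u un
       | lab-t , lab-u ← Labelled-parts {⊗ᶜ} {p} t u lab =
    let
      outside : ∀ {q} → q ∈ PositionsOf ls → q ∉ p ∷ pos u
      outside q∈ls = λ where
        (here refl) → p∉t (main⊆pos σ (meets q∈ls (here refl)))
        (there q∈u) → t#u (main⊆pos σ (meets q∈ls (there (∈-++⁺ʳ (pos t) q∈u))) , q∈u)

      disjoint , p∉₁ , p∉₂ = separate ls σ rs₁ σ′ rs₂ r t#u p∉t p∉u outside
      k = tensor (root t) (root u) p
      S₁ = sequentialise cs σ lab-t ut rs₁ (λ q∈ls q∈t → meets q∈ls (there (∈-++⁺ˡ q∈t))) S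
      -- The main class lies above `t`, so the current net is continued there. Above `u` a new net
      -- begins from its own daimon `d`, with empty context.
      S₂ = sequentialise [] σ′ lab-u uu rs₂ (λ q∈ _ → ∈daimon⁻ r q∈) (start σ′ uu r)
    in
    links-↭
      (↭-trans
        (solve 7 (λ k l t u d₀ d e → k ⊕ ((l ⊕ (t ⊕ d)) ⊕ (d₀ ⊕ (u ⊕ e))) ⊜ l ⊕ ((k ⊕ (t ⊕ u)) ⊕ (d₀ ⊕ (d ⊕ e)))) ↭-refl
          [ k ] ls (tlinks t) (tlinks u) [ daimon d ] (map daimon D₁) (map daimon D₂))
        (↭-reflexive (cong (λ ds → ls ++ (k ∷ tlinks t ++ tlinks u) ++ daimon d ∷ ds) (sym (map-++ daimon D₁ D₂)))))
      (tensor-rule cs [] (lab {⊗ᶜ} (here refl)) disjoint p∉₁ p∉₂ S₁ S₂)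
  sequentialise {ls = ls} cs (splitʳ {p} {t} {u} {m} {n} {os} {qs} σ σ′) lab un (_∷_ {x = d} r rs) meets S
    with D₁ , D₂ , refl , rs₁ , rs₂ ← Pointwise-++⁻ os rs
       | ut , uu , t#u , p∉t , p∉u ← node-parts t u un
       | lab-t , lab-u ← Labelled-parts {⊗ᶜ} {p} t u lab =
    let
      outside : ∀ {q} → q ∈ PositionsOf ls → q ∉ p ∷ pos t
      outside q∈ls = λ where
        (here refl) → p∉u (main⊆pos σ′ (meets q∈ls (here refl)))
        (there q∈t) → t#u (q∈t , main⊆pos σ′ (meets q∈ls (there (∈-++⁺ˡ q∈t))))

      -- The roles are exchanged here: `u` continues the current net and `t` begins the new one,
      -- while the tensor link keeps its left and right inputs.
      disjoint , p∉₂ , p∉₁ = separate ls σ′ rs₂ σ rs₁ r (λ (x∈ , y∈) → t#u (y∈ , x∈)) p∉u p∉t outside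
      k = tensor (root t) (root u) p
      S₁ = sequentialise [] σ lab-t ut rs₁ (λ q∈ _ → ∈daimon⁻ r q∈) (start σ ut r)
      S₂ = sequentialise cs σ′ lab-u uu rs₂ (λ q∈ls q∈u → meets q∈ls (there (∈-++⁺ʳ (pos t) q∈u))) S
    in
    links-↭
      (↭-trans
        (solve 7 (λ k l t u d₀ d e → k ⊕ ((d₀ ⊕ (t ⊕ d)) ⊕ (l ⊕ (u ⊕ e))) ⊜ l ⊕ ((k ⊕ (t ⊕ u)) ⊕ (d₀ ⊕ (d ⊕ e)))) ↭-refl
          [ k ] ls (tlinks t) (tlinks u) [ daimon d ] (map daimon D₁) (map daimon D₂))
        (↭-reflexive (cong (λ ds → ls ++ (k ∷ tlinks t ++ tlinks u) ++ daimon d ∷ ds) (sym (map-++ daimon D₁ D₂)))))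
      (tensor-rule [] cs (lab {⊗ᶜ} (here refl)) (λ (x∈ , y∈) → disjoint (y∈ , x∈)) p∉₁ p∉₂ S₁ S₂)

-- Comparison of the partitions

++-injective : ∀ {A : Set} (as bs : List A) {xs ys} → length as ≡ length bs → as ++ xs ≡ bs ++ ys → as ≡ bs × xs ≡ ys
++-injective []       []       _ e = refl , e
++-injective (a ∷ as) (b ∷ bs) l e =
  let a≡b , e′ = ∷-injective e ; as≡bs , xs≡ys = ++-injective as bs (suc-injective l) e′ in
  cong₂ _∷_ a≡b as≡bs , xs≡ys

-- A total function, rather than a correspondence of indices, allows whole lists of classes to be
-- transported by `map`.
interpolate : ∀ {xs : List Pos} (ys : List Pos) → Unique xs → length xs ≡ length ys → ∃[ ρ ] map ρ xs ≡ ys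
interpolate {[]}     []       _        _ = id , refl
interpolate {x ∷ xs} (y ∷ ys) (x# ∷ u) l =
  let ρ , eq = interpolate ys u (suc-injective l) in
  (λ z → if does (z ≟ x) then y else ρ z) ,
  cong₂ _∷_ (cong (if_then y else ρ x) (dec-true (x ≟ x) refl))
    (trans (map-cong-local (All.map (λ {z} x≢z → cong (if_then y else ρ z) (dec-false (z ≟ x) (≢-sym x≢z))) x#)) eq)

lookup-map : ∀ (ρ : Pos → Pos) {xs ys} → map ρ xs ≡ ys → (i : Fin (length xs)) (j : Fin (length ys)) →
             toℕ i ≡ toℕ j → lookup ys j ≡ ρ (lookup xs i)
lookup-map ρ {x ∷ xs} refl zero    zero    _ = refl
lookup-map ρ {x ∷ xs} refl (suc i) (suc j) e = lookup-map ρ {xs} refl i j (suc-injective e)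

same-index : ∀ (ρ : Pos → Pos) {xs ys} → map ρ xs ≡ ys → (i : Fin (length xs)) → ∃[ j ] toℕ i ≡ toℕ {length ys} j
same-index ρ {x ∷ xs} refl zero    = zero , refl
same-index ρ {x ∷ xs} refl (suc i) = let j , e = same-index ρ {xs} refl i in suc j , cong suc e

map-singleton⁻ : ∀ {A B : Set} (f : A → B) xs {y} → map f xs ≡ y ∷ [] → ∃[ x ] xs ≡ x ∷ [] × f x ≡ y
map-singleton⁻ f (x ∷ []) refl = x , refl , refl

Pointwise-∃ : ∀ {A B : Set} {P : B → Set} {R : B → A → Set} xs → (∀ {x} → x ∈ xs → ∃[ y ] P y × R y x) →
              ∃[ ys ] Pointwise R ys xs × All P ys
Pointwise-∃ []       _ = [] , [] , []
Pointwise-∃ (x ∷ xs) h =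
  let y , p , r = h (here refl) ; ys , rs , ps = Pointwise-∃ xs (λ x∈ → h (there x∈)) in
  y ∷ ys , r ∷ rs , p ∷ ps

Pointwise-preimage : ∀ {A B : Set} {R : B → A → Set} {ys xs x} → Pointwise R ys xs → x ∈ xs → ∃[ y ] y ∈ ys × R y x
Pointwise-preimage (r ∷ _)  (here refl) = _ , here refl , r
Pointwise-preimage (_ ∷ rs) (there x∈)  = let y , y∈ , r = Pointwise-preimage rs x∈ in y , there y∈ , r

Pointwise-image : ∀ {A B : Set} {R : B → A → Set} {ys xs y} → Pointwise R ys xs → y ∈ ys → ∃[ x ] x ∈ xs × R y x
Pointwise-image (r ∷ _)  (here refl) = _ , here refl , r
Pointwise-image (_ ∷ rs) (there y∈)  = let x , x∈ , r = Pointwise-image rs y∈ in x , there x∈ , r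

↭-disjoint : ∀ {D C : List (List Pos)} → Pointwise _↭_ D C → AllPairs Disjoint C → AllPairs Disjoint D
↭-disjoint []       []         = []
↭-disjoint (r ∷ rs) (c# ∷ ds) =
  All.tabulate (λ d∈ (x∈ , y∈) →
    let _ , c∈ , r′ = Pointwise-image rs d∈ in All.lookup c# c∈ (∈-resp-↭ r x∈ , ∈-resp-↭ r′ y∈))
  ∷ ↭-disjoint rs ds

↭-nonEmpty : ∀ {D C : List (List Pos)} → Pointwise _↭_ D C → All NonEmpty C → All NonEmpty D
↭-nonEmpty []       []               = []
↭-nonEmpty (r ∷ rs) ((x , x∈) ∷ ne) = (x , ∈-resp-↭ (↭-sym r) x∈) ∷ ↭-nonEmpty rs ne

-- Upgrades an equality of sets of sets to a bijection. Each member of `ds` has the elements of some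
-- member of `C`, hence is nonempty; nonempty disjoint lists are distinct, so neither `ds` nor the
-- chosen `D` has repetitions, and equality of their members is a permutation. `D` lists the daimons
-- in the order of `C`.
matching : ∀ {ds C : List (List Pos)} → All Unique ds → AllPairs Disjoint ds →
           All Unique C → AllPairs Disjoint C → All NonEmpty C →
           (∀ {d} → d ∈ ds → ∃[ c ] c ∈ C × (∀ {x} → x ∈ d ⇔ x ∈ c)) →
           (∀ {c} → c ∈ C → ∃[ d ] d ∈ ds × (∀ {x} → x ∈ d ⇔ x ∈ c)) →
           ∃[ D ] Pointwise _↭_ D C × D ↭ ds
matching {ds} {C} us disj us′ disj′ ne to from =
  D , D≈C , set⇒↭
    (disjoint⇒Unique (↭-nonEmpty D≈C ne) (↭-disjoint D≈C disj′))
    (disjoint⇒Unique (All.tabulate nonEmpty) disj)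
    (All.lookup D⊆ds) ds⊆D
  where
  same : ∀ {d c} → d ∈ ds → c ∈ C → (∀ {x} → x ∈ d ⇔ x ∈ c) → d ↭ c
  same d∈ c∈ eq = set⇒↭ (All.lookup us d∈) (All.lookup us′ c∈) (Equivalence.to eq) (Equivalence.from eq)
  choice : ∃[ D ] Pointwise _↭_ D C × All (_∈ ds) D
  choice = Pointwise-∃ C λ c∈ → let d , d∈ , eq = from c∈ in d , d∈ , same d∈ c∈ eq
  D : List (List Pos)
  D = proj₁ choice
  D≈C : Pointwise _↭_ D C
  D≈C = proj₁ (proj₂ choice)
  D⊆ds : All (_∈ ds) D
  D⊆ds = proj₂ (proj₂ choice)
  nonEmpty : ∀ {d} → d ∈ ds → NonEmpty d
  nonEmpty d∈ = let c , c∈ , eq = to d∈ ; x , x∈ = All.lookup ne c∈ in x , Equivalence.from eq x∈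
  ds⊆D : ∀ {d} → d ∈ ds → d ∈ D
  ds⊆D {d} d∈ with to d∈
  ... | c , c∈ , eq with Pointwise-preimage D≈C c∈ | All.lookup ne c∈
  ...   | d′ , d′∈ , r | x , x∈
    -- `d` and the daimon `d′` chosen for `c` both contain `x`, so disjointness forces them to
    -- coincide.
    with ∈-AllPairs₂ disj d∈ (All.lookup D⊆ds d′∈) | Equivalence.from eq x∈ | ∈-resp-↭ (↭-sym r) x∈
  ...     | inj₁ refl      | _   | _    = d′∈
  ...     | inj₂ (inj₁ d#) | x∈d | x∈d′ = ⊥-elim (d# (x∈d , x∈d′))
  ...     | inj₂ (inj₂ d#) | x∈d | x∈d′ = ⊥-elim (d# (x∈d′ , x∈d))

-- Switchings read on the dual tree

module Duality (𝒱 : PropVars) where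
  open Logic 𝒱
  open Shapes 𝒱

  same-length : ∀ {t t′ A} → Shape t A → Shape t′ (A ^⊥) → length (leaves t) ≡ length (leaves t′)
  same-length leaf leaf = refl
  same-length (node⊗ {t = t} {u} s s′) (node⅋ {t = t′} {u′} r r′) =
    trans (length-++ (leaves t)) (trans (cong₂ _+_ (same-length s r) (same-length s′ r′)) (sym (length-++ (leaves t′))))
  same-length (node⅋ {t = t} {u} s s′) (node⊗ {t = t′} {u′} r r′) =
    trans (length-++ (leaves t)) (trans (cong₂ _+_ (same-length s r) (same-length s′ r′)) (sym (length-++ (leaves t′))))

  leaves-++⁻ : ∀ ρ t t′ {A xs ys} → Shape t A → Shape t′ (A ^⊥) →
               map ρ (leaves t ++ xs) ≡ leaves t′ ++ ys →
               map ρ (leaves t) ≡ leaves t′ × map ρ xs ≡ ys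
  leaves-++⁻ ρ t t′ s r eq =
    ++-injective (map ρ (leaves t)) (leaves t′) (trans (length-map ρ (leaves t)) (same-length s r))
      (trans (sym (map-++ ρ (leaves t) _)) eq)

  -- Dual formulas have equally many atoms on each side of their main connective, so the equation
  -- between leaf lists splits at every node and the choices of the switching can be copied
  -- unchanged.
  dualise : ∀ ρ t t′ {A m os} → Shape t A → Shape t′ (A ^⊥) → map ρ (leaves t) ≡ leaves t′ →
            Switched ⅋ᶜ t m os → Switched ⊗ᶜ t′ (map ρ m) (map (map ρ) os)
  dualise ρ _ _ leaf leaf refl leaf = leaf
  dualise ρ (node _ _ t u) (node _ _ t′ u′) (node⊗ s s′) (node⅋ r r′) eq (join {m = m} {n} {os} {qs} _ σ σ′) =
    let e , e′ = leaves-++⁻ ρ t t′ s r eq in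
    subst₂ (Switched ⊗ᶜ _) (sym (map-++ ρ m n)) (sym (map-++ (map ρ) os qs))
      (join (λ ()) (dualise ρ t t′ s r e σ) (dualise ρ u u′ s′ r′ e′ σ′))
  dualise ρ _ _ (node⅋ _ _) (node⊗ _ _) eq (join ⅋≢⅋ _ _) = contradiction refl ⅋≢⅋
  dualise ρ (node _ _ t u) (node _ _ t′ u′) (node⅋ s s′) (node⊗ r r′) eq (splitˡ {n = n} {os} {qs} σ σ′) =
    let e , e′ = leaves-++⁻ ρ t t′ s r eq in
    subst (λ z → Switched ⊗ᶜ _ _ (map ρ n ∷ z)) (sym (map-++ (map ρ) os qs))
      (splitˡ (dualise ρ t t′ s r e σ) (dualise ρ u u′ s′ r′ e′ σ′))
  dualise ρ (node _ _ t u) (node _ _ t′ u′) (node⅋ s s′) (node⊗ r r′) eq (splitʳ {m = m} {os = os} {qs} σ σ′) =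
    let e , e′ = leaves-++⁻ ρ t t′ s r eq in
    subst (λ z → Switched ⊗ᶜ _ _ (map ρ m ∷ z)) (sym (map-++ (map ρ) os qs))
      (splitʳ (dualise ρ t t′ s r e σ) (dualise ρ u u′ s′ r′ e′ σ′))

-- The classes of a switching as leaf lists

module SwitchedNet (𝒱 : PropVars) (N : Net) (cutFree : CutFree (graph N))
  (τ : Pos → Logic.Formula 𝒱) (labelling : Logic.IsAtomicLabelling 𝒱 (graph N) τ)
  (c₀ : Pos) (conclusions≡ : conclusions (graph N) ≡ c₀ ∷ []) (σ : Switching (graph N)) where

  open LabelledNet 𝒱 N cutFree τ labelling c₀ conclusions≡ public

  initially : Reads G id (tree ∷ [])
  initially =
    let ds , eq , _ = decomposition in record
    { daimons      = ds
    ; links↭       = ↭-trans eq (++⁺ʳ _ (↭-reflexive (begin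
        tlinks tree                          ≡⟨ ++-identityʳ (tlinks tree) ⟨
        tlinks tree ++ []                    ≡⟨ map-id _ ⟨
        map id (tlinks tree ++ [])           ≡⟨ map-cong (λ l → sym (rename-id l)) _ ⟩
        map (rename id) (tlinks tree ++ [])  ∎)))
    ; conclusions↭ = ↭-reflexive (trans conclusions≡ (cong [_] (sym root≡)))
    ; apart        = subst Unique (sym (++-identityʳ (pos tree))) tree-unique
    }
    where open ≡-Reasoning

  abstract
    simulated : ∃[ F ] Reads (Switching.result σ) (identify (steps σ)) F ×
                       (∀ {cs} → SwitchedForest F cs → ∃[ cs′ ] SwitchedForest (tree ∷ []) cs′ × cs′ ↭ cs)
    simulated = simulate (steps σ) initially

  F : Forest
  F = proj₁ simulated

  final : Reads (Switching.result σ) (identify (steps σ)) F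
  final = proj₁ (proj₂ simulated)

  abstract
    -- In the final forest no par is left, so the leaves of each tree form a single class; this
    -- trivial switching is carried back to the initial tree.
    switched : ∃₂ λ m os → Switched ⅋ᶜ tree m os × m ∷ os ↭ map leaves F
    switched with proj₂ (proj₂ simulated) (par-free-SwitchedForest F (normal⇒par-free final (normal σ)))
    ... | _ , _∷_ {m = m} {os} ω [] , eq = m , os , ω , ↭-trans (↭-reflexive (cong (m ∷_) (sym (++-identityʳ os)))) eq

  open Classes final

  class-of : ∀ {t} → t ∈ F → Index (↑ⁱ G σ)
  class-of {t} t∈ = identify (steps σ) (root t) ,
    ∈-resp-↭ (↭-sym (Reads.conclusions↭ final)) (∈-map⁺ (identify (steps σ) ∘ root) t∈)

  leaf∈forest : ∀ {x} → x ∈ leaves tree → ∃[ u ] u ∈ F × x ∈ leaves u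
  leaf∈forest x∈ with switched
  ... | m , os , ω , eq with ∈-concat⁻′ (m ∷ os) (∈-resp-↭ (↭-sym (Switched-leaves ω)) x∈)
  ...   | c , x∈c , c∈ with ∈-map⁻ leaves (∈-resp-↭ eq c∈)
  ...     | u , u∈ , refl = u , u∈ , x∈c

  forest∈leaf : ∀ {x t} → t ∈ F → x ∈ leaves t → x ∈ leaves tree
  forest∈leaf t∈ x∈ with switched
  ... | m , os , ω , eq =
    ∈-resp-↭ (Switched-leaves ω) (∈-concat⁺′ x∈ (∈-resp-↭ (↭-sym eq) (∈-map⁺ leaves t∈)))

  class⇔ : ∀ {t x} (t∈ : t ∈ F) → class (↑ⁱ G σ) (class-of t∈) x ⇔ x ∈ leaves t
  class⇔ {t} t∈ = mk⇔
    (λ (ini , ss) → let u , u∈ , x∈ = leaf∈forest (initial∈leaves ini) in below-root t∈ u∈ x∈ ss)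
    (λ x∈ → Sub.leaves⊆ tree-sub (forest∈leaf t∈ x∈) , climb-forest t∈ x∈)

  class-tree : (i : Index (↑ⁱ G σ)) → ∃[ t ] t ∈ F × (∀ {x} → class (↑ⁱ G σ) i x ⇔ x ∈ leaves t)
  class-tree (q , q∈) with ∈-map⁻ _ (∈-resp-↭ (Reads.conclusions↭ final) q∈)
  ... | t , t∈ , refl = t , t∈ , λ {x} → mk⇔ (Equivalence.to (class⇔ {x = x} t∈)) (Equivalence.from (class⇔ {x = x} t∈))

-- Typing a test

module Test (𝒱 : PropVars) (A : Logic.Formula 𝒱) (T : Net) (test : Logic.IsTest 𝒱 T A) where

  open Logic 𝒱
  open IsTest test
  open Shapes 𝒱
  open Duality 𝒱

  τT : Pos → Formula
  τT = proj₁ T-testable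

  T-conclusion = map-singleton⁻ τT (conclusions (graph T)) (proj₂ (proj₂ T-testable))
  τS : Pos → Formula
  τS = proj₁ S-testable
  S-conclusion = map-singleton⁻ τS (conclusions (graph S)) (proj₂ (proj₂ S-testable))

  module 𝒯 = LabelledNet 𝒱 T T-cutFree τT (proj₁ (proj₂ T-testable)) (proj₁ T-conclusion) (proj₁ (proj₂ T-conclusion))
  module 𝒮 = SwitchedNet 𝒱 S S-cutFree τS (proj₁ (proj₂ S-testable)) (proj₁ S-conclusion) (proj₁ (proj₂ S-conclusion)) σ

  T-shape : Shape 𝒯.tree (A ^⊥)
  T-shape = subst (Shape 𝒯.tree) (proj₂ (proj₂ T-conclusion)) 𝒯.tree-shape
  S-shape : Shape 𝒮.tree A
  S-shape = subst (Shape 𝒮.tree) (proj₂ (proj₂ S-conclusion)) 𝒮.tree-shape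

  abstract
    interpolation : ∃[ ρ ] map ρ (leaves 𝒮.tree) ≡ leaves 𝒯.tree
    interpolation = interpolate (leaves 𝒯.tree) (leaves-unique 𝒮.tree 𝒮.tree-unique) (same-length S-shape T-shape)

  ρ : Pos → Pos
  ρ = proj₁ interpolation

  ρ-leaves : map ρ (leaves 𝒮.tree) ≡ leaves 𝒯.tree
  ρ-leaves = proj₂ interpolation

  Numbered-ρ : ∀ {k x y} → Numbered (graph S) k x → Numbered (graph T) k y → y ≡ ρ x
  Numbered-ρ nx ny with Equivalence.to 𝒮.Numbered⇔ nx | Equivalence.to 𝒯.Numbered⇔ ny
  ... | i , refl , refl | j , eq , refl = lookup-map ρ ρ-leaves i j (suc-injective eq)

  number : ∀ {x} → x ∈ leaves 𝒮.tree → ∃[ k ] Numbered (graph S) k x × Numbered (graph T) k (ρ x)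
  number {x} x∈ =
    let i = index x∈ ; j , e = same-index ρ ρ-leaves i in
    suc (toℕ i) , Equivalence.from 𝒮.Numbered⇔ (i , refl , lookup-index x∈) ,
    Equivalence.from 𝒯.Numbered⇔ (j , cong suc e ,
      trans (cong ρ (lookup-index x∈)) (sym (lookup-map ρ ρ-leaves i j e)))

  -- On leaves, `ρ` preserves the number, so an equality of numbered classes says that one is the
  -- image of the other. The two inclusions ensure that every member has a number.
  same-class : ∀ {P Q : Pos → Set} → (∀ {y} → P y → y ∈ leaves 𝒯.tree) → (∀ {x} → Q x → x ∈ leaves 𝒮.tree) →
    (λ k → ∃[ p ] Numbered (graph T) k p × P p) ≐ (λ k → ∃[ p ] Numbered (graph S) k p × Q p) →
    ∀ {y} → P y ⇔ (∃[ x ] Q x × y ≡ ρ x)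
  same-class {P} {Q} P⊆ Q⊆ (to , from) = mk⇔ forth back
    where
    forth : ∀ {y} → P y → ∃[ x ] Q x × y ≡ ρ x
    forth {y} py with ∈-map⁻ ρ (subst (y ∈_) (sym ρ-leaves) (P⊆ py))
    ... | x , x∈ , refl with number x∈
    ...   | k , _ , ny with to (_ , ny , py)
    ...     | x′ , nx′ , qx′ = x′ , qx′ , Numbered-ρ nx′ ny
    back : ∀ {y} → (∃[ x ] Q x × y ≡ ρ x) → P y
    back (x , qx , refl) with number (Q⊆ qx)
    ... | k , nx , _ with from (_ , nx , qx)
    ...   | y′ , ny′ , py′ = subst P (Numbered-ρ nx ny′) py′

  typeable : T ⊢ A ^⊥ ∷ []
  typeable with 𝒮.switched | 𝒯.decomposition
  ... | m , os , ω , eq | ds , links↭ , ds-disjoint =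
    conclude (matching
      (All.tabulate λ d∈ → WellFormed.target-distinct (IsNet.wellFormed (isNet T) (daimon∈ d∈)))
      ds-disjoint (proj₁ C-classes) (proj₂ C-classes) (Switched-nonEmpty ω′) to from)
    where
    open Sequentialisation 𝒱 τT

    C : List (List Pos)
    C = map (map ρ) (m ∷ os)

    ω′ : Switched ⊗ᶜ 𝒯.tree (map ρ m) (map (map ρ) os)
    ω′ = dualise ρ 𝒮.tree 𝒯.tree S-shape T-shape ρ-leaves ω

    C-classes : All Unique C × AllPairs Disjoint C
    C-classes = Unique-concat⁻ C (Unique-↭ (↭-sym (Switched-leaves ω′)) (leaves-unique 𝒯.tree 𝒯.tree-unique))

    daimon∈ : ∀ {d} → d ∈ ds → daimon d ∈ links (graph T)
    daimon∈ d∈ = ∈-resp-↭ (↭-sym links↭) (∈-++⁺ʳ (tlinks 𝒯.tree) (∈-map⁺ daimon d∈))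

    ∈daimons : ∀ {d} → daimon d ∈ links (graph T) → d ∈ ds
    ∈daimons d∈ with ∈-++⁻ (tlinks 𝒯.tree) (∈-resp-↭ links↭ d∈)
    ... | inj₁ d∈t = let c , _ , _ , _ , e , _ = ∈tlinks 𝒯.tree d∈t in contradiction (sym e) (link≢daimon c)
    ... | inj₂ d∈d with ∈-map⁻ daimon d∈d
    ...   | _ , d∈ds , refl = d∈ds

    same : ∀ {d t} (d∈ : daimon d ∈ links (graph T)) (i : Index (↑ⁱ (graph S) σ)) → t ∈ 𝒮.F →
           (∀ {x} → class (↑ⁱ (graph S) σ) i x ⇔ x ∈ leaves t) →
           class (Nat (graph T) (P✠ (graph T))) (d , d∈) ≐ class (Nat (graph S) (↑ⁱ (graph S) σ)) i →
           ∀ {y} → y ∈ d ⇔ y ∈ map ρ (leaves t)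
    same {d} {t} d∈ i t∈ i⇔ cl {y} = mk⇔
      (λ y∈ → let x , qx , y≡ = Equivalence.to equiv y∈ in
              subst (_∈ map ρ (leaves t)) (sym y≡) (∈-map⁺ ρ (Equivalence.to i⇔ qx)))
      (λ y∈ → let x , x∈ , y≡ = ∈-map⁻ ρ y∈ in Equivalence.from equiv (x , Equivalence.from i⇔ x∈ , y≡))
      where
      equiv : y ∈ d ⇔ (∃[ x ] class (↑ⁱ (graph S) σ) i x × y ≡ ρ x)
      equiv = same-class {P = _∈ d} {Q = class (↑ⁱ (graph S) σ) i}
        (λ y∈ → 𝒯.initial∈leaves (_ , d∈ , y∈)) (λ qx → 𝒮.forest∈leaf t∈ (Equivalence.to i⇔ qx)) cl

    to : ∀ {d} → d ∈ ds → ∃[ c ] c ∈ C × (∀ {y} → y ∈ d ⇔ y ∈ c)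
    to {d} d∈ =
      let i , cl = proj₁ samePartition (d , daimon∈ d∈)
          t , t∈ , i⇔ = 𝒮.class-tree i
      in map ρ (leaves t) , ∈-map⁺ (map ρ) (∈-resp-↭ (↭-sym eq) (∈-map⁺ leaves t∈)) ,
         same (daimon∈ d∈) i t∈ i⇔ cl

    from : ∀ {c} → c ∈ C → ∃[ d ] d ∈ ds × (∀ {y} → y ∈ d ⇔ y ∈ c)
    from c∈ with ∈-map⁻ (map ρ) c∈
    ... | _ , c′∈ , refl with ∈-map⁻ leaves (∈-resp-↭ eq c′∈)
    ...   | t , t∈ , refl =
      let (d , d∈) , cl = proj₂ samePartition (𝒮.class-of t∈) in
      d , ∈daimons d∈ , same d∈ (𝒮.class-of t∈) t∈ (λ {x} → 𝒮.class⇔ {x = x} t∈) cl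

    conclude : ∃[ D ] Pointwise _↭_ D C × D ↭ ds → T ⊢ A ^⊥ ∷ []
    -- The matching follows the order of `C`, whose head is the main class: `d` is the daimon to
    -- start from, and `D` lists the others in the order in which the tensors call for them.
    conclude (d ∷ D , r ∷ rs , dD↭) =
      subst (λ Γ → ∃ λ (π : Proof Γ) → Represents (graph T) π)
        (trans (cong (map τT) (sym conclusions≡)) (proj₂ (proj₂ T-testable)))
        (subst (λ cs → Provable (map τT [ root 𝒯.tree ]) (links (graph T)) cs) (sym conclusions≡) sequent)
      where
      conclusions≡ : conclusions (graph T) ≡ [ root 𝒯.tree ]
      conclusions≡ = trans (proj₁ (proj₂ T-conclusion)) (cong [_] (sym 𝒯.root≡))
      sequent : Seq (links (graph T)) [ root 𝒯.tree ]
      sequent = links-↭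
        (↭-trans (↭-sym (shift (daimon d) (tlinks 𝒯.tree) (map daimon D)))
          (↭-trans (++⁺ˡ (tlinks 𝒯.tree) (map⁺ daimon dD↭)) (↭-sym links↭)))
        (sequentialise [] ω′ (λ {c} l∈ → 𝒯.τ-link c (𝒯.Sub.tlinks⊆ 𝒯.tree-sub l∈)) 𝒯.tree-unique rs
          (λ q∈ _ → ∈daimon⁻ r q∈) (start ω′ 𝒯.tree-unique r))

theorem77 : (𝒱 : PropVars) → let open Logic 𝒱 in
    (A : Formula) (T : Net) → IsTest T A → T ⊢ A ^⊥ ∷ []
theorem77 𝒱 A T test = Test.typeable 𝒱 A T test
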